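{- Let $h$ be an arbitrary simple graph on $\{1,\ldots,n\}$ and let $z(i)$, $z(i_1,i_2)$, $\ldots$, $z(i_1,\ldots,i_k)\geq0$ be its local invariant vectors (for sequences of distinct vertices) with respect to the finite local $G$-posets $\mathcal{E}_1,\mathcal{E}_{1,2},\ldots,\mathcal{E}_{1,\ldots,k}$. These parameters satisfy: (i) the conjugate equations $$z(i_1,\ldots,i_k)^\pi=z(i_{\pi(1)},\ldots,i_{\pi(k)})$$ for all permutations $\pi\in S_k$; (ii) the sums $$\sum_{i_k\neq i_1,\ldots,i_{k-1}}z(i_1,\ldots,i_k)=D_{1,\ldots,k}P_{1,\ldots,k}\,z(i_1,\ldots,i_{k-1});$$ (iii) for all $a,b$ such that the product of the local invariants $I_{1,\ldots,k}(g_a)I_{1,\ldots,k}(g_b)$ can be expressed as a linear combination of the invariants of the elements of the local $G$-poset $\mathcal{E}_{1,\ldots,k}=\{g_1,\ldots,g_{r_k}\}$, $$z(i_1,\ldots,i_k)_a\,z(i_1,\ldots,i_k)_b=(E_{1,\ldots,k}^{ -1}p)^Tz(i_1,\ldots,i_k),$$ where $$p=[I_{1,\ldots,k}(g_a)(g_1)I_{1,\ldots,k}(g_b)(g_1),\ldots,I_{1,\ldots,k}(g_a)(g_{r_k})I_{1,\ldots,k}(g_b)(g_{r_k})]^T.$$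
   Context: Graphs are finite and simple. Fix $r,d\ge1$ and let $\mathcal{E}$ be the class of graphs with vertex degrees at most $d$. $U_r(i,g)$ is the subgraph of $g$ formed by all vertices at distance at most $r$ from $i$ and all edges of $g$ between them. For $k\ge1$, $$\mathcal{E}_{1,\ldots,k}=\{U_r(1,g^\pi)\cap\cdots\cap U_r(k,g^\pi)\mid\pi\in S_n,\ g\in\mathcal{E}\},$$ where $1,\ldots,k$ are fixed points and elements are considered up to isomorphisms fixing each of $1,\ldots,k$; its nonempty elements are $g_1(1,\ldots,k),\ldots,g_{r_k}(1,\ldots,k)$ (a finite set). The graph $h$ itself is not restricted in any way. The local invariant $I_{1,\ldots,k}(g)$ evaluated at $(i_1,\ldots,i_k)$ in $h$ is the number of subgraphs of $h$ that are images of $g$ under injective vertex maps sending $j$ to $i_j$ for $j=1,\ldots,k$; for $i_j=j$ it is written $I_{1,\ldots,k}(g)(h)$. The $t$-th component $z(i_1,\ldots,i_k)_t$ of the local invariant vector is this value for $g=g_t(1,\ldots,k)$. $E_{1,\ldots,k}$ is the $r_k\times r_k$ matrix with $(a,b)$ entry $I_{1,\ldots,k}(g_b)(g_a)$. $P_{1,\ldots,k}$ is the $r_k\times r_{k-1}$ matrix with $(t,u)$ entry $1$ if $g_t(1,\ldots,k)$, regarded as a local graph with fixed points $1,\ldots,k-1$ only, is $g_u(1,\ldots,k-1)$, and $0$ otherwise. $D_{1,\ldots,k}$ is the diagonal matrix with $t$-th entry $|Orb_{Stab(g_t(1,\ldots,k-1))}(k)|$, the size of the orbit of the vertex $k$ under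 the group of permutations in $S_n$ fixing $1,\ldots,k-1$ and mapping $g_t$ to itself. Conjugation: for $\pi\in S_k$ let $g_t^\pi$ be $g_t(1,\ldots,k)$ with each fixed point $j$ relabeled $\pi(j)$; $z^\pi$ is the vector whose $t$-th component is $z_{t'}$, where $g_{t'}\cong g_t^\pi$ via an isomorphism fixing $1,\ldots,k$.
   Formalization: The sums (ii) are asserted only for components t where g_t(1,…,k), regarded with fixed points 1,…,k−1, is some g_u(1,…,k−1); otherwise row t of P is zero and (ii) fails (e.g. r=1, k=2, g the path 1–3–2, intersection the vertex 3). -}

module Defs where

open import Algebra.Bundles using (Semiring; module CommutativeRing)
open import Data.Bool.Base using (Bool; true; false; if_then_else_)
import Data.Bool.Properties as Bool
open import Data.Fin.Base using (Fin; zero; suc; toℕ; fromℕ; fromℕ<; inject≤)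
open import Data.Fin.Permutation using (Permutation′; permutation; _⟨$⟩ʳ_; _⟨$⟩ˡ_; inverseˡ; inverseʳ; id; flip; _∘ₚ_)
open import Data.Fin.Properties using (_≟_; any?; all?)
open import Data.Fin.Subset using (Subset; _∈_; _⊆_; _∩_; ∣_∣; ⊤; Nonempty)
open import Data.Fin.Subset.Properties using (_∈?_; _⊆?_; nonempty?)
open import Data.Integer.Base using (+_)
open import Data.List.Base as List using (List; filter; length; cartesianProductWith; deduplicate)
open import Data.List.Membership.Propositional using () renaming (_∈_ to _∈ᴸ_)
open import Data.List.Membership.Propositional.Properties
  using (∈-cartesianProductWith⁺; ∈-deduplicate⁻; ∈-filter⁺; ∈-filter⁻; ∈-lookup)
import Data.List.Relation.Unary.All as All
open import Data.List.Relation.Unary.AllPairs as AllPairs using (AllPairs)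
open import Data.List.Relation.Unary.Any as Any using (Any; here; there)
import Data.List.Relation.Unary.Any.Properties as Any
open import Data.List.Relation.Unary.Unique.DecSetoid.Properties using (deduplicate-!)
open import Data.Nat.Base using (ℕ; zero; suc; _≤_)
open import Data.Nat.Properties using (_<?_; _≤?_; +-*-semiring; <⇒≤)
open import Data.Product.Base using (Σ-syntax; ∃; ∃-syntax; _×_; _,_; proj₂)
open import Data.Rational.Base using (ℚ; _/_) renaming (_*_ to _*ℚ_)
open import Data.Rational.Properties using (+-*-commutativeRing)
open import Data.Sum.Base using (_⊎_)
open import Data.Vec.Base using (Vec; []; _∷_; lookup; tabulate; zipWith; foldr₁; _∷ʳ_)
open import Data.Vec.Functional using (Vector; head; tail) renaming (_∷_ to _◂_; [] to ⟨⟩)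
import Data.Vec.Membership.DecPropositional as DecMembership
open import Data.Vec.Properties
  using (≡-dec; tabulate-cong; lookup∘tabulate; tabulate∘lookup; []=⇒lookup; lookup⇒[]=)
open import Data.Vec.Relation.Unary.Unique.Propositional using (Unique)
open import Function.Base using (_∘_)
open import Function.Bundles using (_⇔_; mk⇔; module Equivalence)
open import Function.Definitions using (Injective)
open import Level using (0ℓ)
open import Relation.Binary.Bundles using (DecSetoid)
open import Relation.Binary.Definitions using (_Respects_; DecidableEquality)
open import Relation.Binary.PropositionalEquality
  using (_≡_; _≗_; refl; sym; trans; cong; cong₂; subst)
open import Relation.Nullary using (Dec; does; yes; no; ¬_; contradiction)
open import Relation.Nullary.Decidable using (map′; _×-dec_; _⊎-dec_; _→-dec_; ¬?; does-⇔; dec-true)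
open import Relation.Unary using (Pred; Decidable)
import Algebra.Properties.Semiring.Sum as SemiringSum

------------------------------------------------------------------------
-- Vectors and matrices over a semiring

Matrix : ∀ {a} → Set a → ℕ → ℕ → Set a
Matrix A m n = Fin m → Fin n → A

module Linear {c ℓ} (R : Semiring c ℓ) where
  open Semiring R using (Carrier; _≈_; _+_; _*_; 0#; 1#)
  open SemiringSum R using (sum-syntax)

  infixr 7 _·ⱽ_ _·ᴹ_
  infix  6 _∙_

  _·ⱽ_ : ∀ {m n} → Matrix Carrier m n → Vector Carrier n → Vector Carrier m
  _·ⱽ_ {n = n} A x i = ∑[ j < n ] (A i j * x j)

  _·ᴹ_ : ∀ {m n o} → Matrix Carrier m n → Matrix Carrier n o → Matrix Carrier m o
  _·ᴹ_ {n = n} A B i k = ∑[ j < n ] (A i j * B j k)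

  _∙_ : ∀ {n} → Vector Carrier n → Vector Carrier n → Carrier
  _∙_ {n} x y = ∑[ j < n ] (x j * y j)

  diag : ∀ {n} → Vector Carrier n → Matrix Carrier n n
  diag x i j = if does (i ≟ j) then x i else 0#

  1ᴹ : ∀ {n} → Matrix Carrier n n
  1ᴹ = diag (λ _ → 1#)

  IsInverse : ∀ {n} → Matrix Carrier n n → Matrix Carrier n n → Set ℓ
  IsInverse A B = (∀ i j → (A ·ᴹ B) i j ≈ 1ᴹ i j) × (∀ i j → (B ·ᴹ A) i j ≈ 1ᴹ i j)

module Linearℕ = Linear +-*-semiring
module Linearℚ = Linear (CommutativeRing.semiring +-*-commutativeRing)

infix 8 _↑ℚ

_↑ℚ : ℕ → ℚ
m ↑ℚ = + m / 1

------------------------------------------------------------------------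
-- Finite search and enumeration

⟪_⟫ : ∀ {n p} {P : Pred (Fin n) p} → Decidable P → Subset n
⟪ P? ⟫ = tabulate (does ∘ P?)

⟪⟫-cong : ∀ {n p q} {P : Pred (Fin n) p} {Q : Pred (Fin n) q}
          (P? : Decidable P) (Q? : Decidable Q) → (∀ v → P v ⇔ Q v) → ⟪ P? ⟫ ≡ ⟪ Q? ⟫
⟪⟫-cong P? Q? eq = tabulate-cong λ v → does-⇔ (eq v) (P? v) (Q? v)

∈⟪⟫⁺ : ∀ {n p} {P : Pred (Fin n) p} (P? : Decidable P) {v} → P v → v ∈ ⟪ P? ⟫
∈⟪⟫⁺ P? {v} pv = lookup⇒[]= v _ (trans (lookup∘tabulate _ v) (dec-true (P? v) pv))

∈⟪⟫⁻ : ∀ {n p} {P : Pred (Fin n) p} (P? : Decidable P) {v} → v ∈ ⟪ P? ⟫ → P v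
∈⟪⟫⁻ P? {v} v∈ with P? v | trans (sym (lookup∘tabulate (does ∘ P?) v)) ([]=⇒lookup v∈)
... | yes pv | _  = pv
... | no  _  | ()

⟪∈⟫ : ∀ {n} (W : Subset n) → ⟪ _∈? W ⟫ ≡ W
⟪∈⟫ W = trans (tabulate-cong does≡) (tabulate∘lookup W)
  where
  does≡ : ∀ v → does (v ∈? W) ≡ lookup W v
  does≡ v with lookup W v in eq
  ... | true  = dec-true (v ∈? W) (lookup⇒[]= v W eq)
  ... | false with v ∈? W
  ...   | no  _  = refl
  ...   | yes v∈ = trans (sym ([]=⇒lookup v∈)) eq

anyMap? : ∀ {m n p} {P : Pred (Fin m → Fin n) p} →
          P Respects _≗_ → Decidable P → Dec (∃ P)
anyMap? {zero}  resp P? = map′ (⟨⟩ ,_) (λ (f , pf) → resp (λ ()) pf) (P? ⟨⟩)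
anyMap? {suc m} {P = P} resp P? =
  map′ (λ (x , f , pf) → x ◂ f , pf)
       (λ (f , pf) → head f , tail f , resp (λ { zero → refl ; (suc _) → refl }) pf)
       (any? λ x → anyMap? {P = P ∘ (x ◂_)}
         (λ f≗g → resp λ { zero → refl ; (suc i) → f≗g i }) (P? ∘ (x ◂_)))

anyPerm? : ∀ {n p} {P : Pred (Fin n → Fin n) p} →
           P Respects _≗_ → Decidable P → Dec (∃[ σ ] P (σ ⟨$⟩ʳ_))
anyPerm? resp P? =
  map′ (λ (f , pf , g , fg , gf) → permutation f g fg gf , pf)
       (λ (σ , pσ) → σ ⟨$⟩ʳ_ , pσ , σ ⟨$⟩ˡ_ , (λ _ → inverseʳ σ) , (λ _ → inverseˡ σ))
       (anyMap?
         (λ f≗f′ (pf , g , fg , gf) → resp f≗f′ pf , g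
           , (λ v → trans (sym (f≗f′ (g v))) (fg v))
           , (λ v → trans (cong g (sym (f≗f′ v))) (gf v)))
         (λ f → P? f ×-dec anyMap?
           (λ g≗g′ (fg , gf) → (λ v → trans (cong f (sym (g≗g′ v))) (fg v))
                              , (λ v → trans (sym (g≗g′ (f v))) (gf v)))
           (λ g → all? (λ v → f (g v) ≟ v) ×-dec all? (λ v → g (f v) ≟ v))))

injective? : ∀ {m n} → Decidable {A = Fin m → Fin n} (Injective _≡_ _≡_)
injective? f = map′ (λ inj {u} {v} → inj u v) (λ inj u v → inj {u} {v})
  (all? λ u → all? λ v → (f u ≟ f v) →-dec (u ≟ v))

injective-resp : ∀ {m n} → (Injective _≡_ _≡_) Respects (_≗_ {A = Fin m} {B = Fin n})
injective-resp f≗g inj {u} {v} gu≡gv = inj (trans (f≗g u) (trans gu≡gv (sym (f≗g v))))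

vecs : ∀ {a} {A : Set a} → List A → ∀ n → List (Vec A n)
vecs xs zero    = List.[ [] ]
vecs xs (suc n) = cartesianProductWith _∷_ xs (vecs xs n)

∈-vecs : ∀ {a} {A : Set a} {xs : List A} → (∀ x → x ∈ᴸ xs) → ∀ {n} (v : Vec A n) → v ∈ᴸ vecs xs n
∈-vecs all []      = here refl
∈-vecs all (x ∷ v) = ∈-cartesianProductWith⁺ _∷_ (all x) (∈-vecs all v)

------------------------------------------------------------------------
-- Graphs whose vertices are among the n elements of Fin n

-- This is raw data; `Simple` says that it is a simple graph. Equality of
-- simple graphs is propositional equality of their data.
record Graph (n : ℕ) : Set where
  constructor mkGraph
  field
    vertices   : Subset n
    neighbours : Vec (Subset n) n

open Graph public

Adj : ∀ {n} → Graph n → Fin n → Fin n → Set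
Adj g u v = v ∈ lookup (neighbours g) u

adj? : ∀ {n} (g : Graph n) u v → Dec (Adj g u v)
adj? g u v = v ∈? lookup (neighbours g) u

record Simple {n} (g : Graph n) : Set where
  field
    incident    : ∀ {u v} → Adj g u v → u ∈ vertices g
    symmetric   : ∀ {u v} → Adj g u v → Adj g v u
    irreflexive : ∀ {u} → ¬ Adj g u u

-- The vertex set is the whole of Fin n.
Spanning : ∀ {n} → Graph n → Set
Spanning g = vertices g ≡ ⊤

MaxDegree : ∀ {n} → ℕ → Graph n → Set
MaxDegree d g = ∀ v → ∣ lookup (neighbours g) v ∣ ≤ d

_≟ᴳ_ : ∀ {n} → DecidableEquality (Graph n)
mkGraph V N ≟ᴳ mkGraph V′ N′ =
  map′ (λ (p , q) → cong₂ mkGraph p q) (λ { refl → refl , refl })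
       (≡-dec Bool._≟_ V V′ ×-dec ≡-dec (≡-dec Bool._≟_) N N′)

simple? : ∀ {n} (g : Graph n) → Dec (Simple g)
simple? g = map′
  (λ (i , s , r) → record { incident = i _ _ ; symmetric = s _ _ ; irreflexive = r _ })
  (λ S → let open Simple S in
    (λ _ _ → incident) , (λ _ _ → symmetric) , (λ _ → irreflexive))
  ( all? (λ u → all? λ v → adj? g u v →-dec (u ∈? vertices g))
  ×-dec all? (λ u → all? λ v → adj? g u v →-dec adj? g v u)
  ×-dec all? (λ u → ¬? (adj? g u u)))

subsets : ∀ n → List (Subset n)
subsets = vecs (true List.∷ false List.∷ List.[])

∈-subsets : ∀ {n} (W : Subset n) → W ∈ᴸ subsets n
∈-subsets = ∈-vecs λ { true → here refl ; false → there (here refl) }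

graphs : ∀ n → List (Graph n)
graphs n = cartesianProductWith mkGraph (subsets n) (vecs (subsets n) n)

∈-graphs : ∀ {n} (g : Graph n) → g ∈ᴸ graphs n
∈-graphs (mkGraph V N) = ∈-cartesianProductWith⁺ mkGraph (∈-subsets V) (∈-vecs ∈-subsets N)

anyGraph? : ∀ {n p} {P : Pred (Graph n) p} → Decidable P → Dec (∃ P)
anyGraph? P? = map′ Any.satisfied
  (λ (g , pg) → Any.map (λ { refl → pg }) (∈-graphs g)) (Any.any? P? (graphs _))

infix 4 _⊑_ _⊑?_

_⊑_ : ∀ {n} → Graph n → Graph n → Set
s ⊑ h = vertices s ⊆ vertices h × (∀ u → lookup (neighbours s) u ⊆ lookup (neighbours h) u)

_⊑?_ : ∀ {n} (s h : Graph n) → Dec (s ⊑ h)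
s ⊑? h = (vertices s ⊆? vertices h)
         ×-dec all? (λ u → lookup (neighbours s) u ⊆? lookup (neighbours h) u)

infixr 7 _∩ᴳ_

_∩ᴳ_ : ∀ {n} → Graph n → Graph n → Graph n
g ∩ᴳ g′ = mkGraph (vertices g ∩ vertices g′) (zipWith _∩_ (neighbours g) (neighbours g′))

module _ {n} (f : Fin n → Fin n) (g : Graph n) where

  ImageVertex : Fin n → Set
  ImageVertex v = ∃[ u ] f u ≡ v × u ∈ vertices g

  ImageAdj : Fin n → Fin n → Set
  ImageAdj v w = ∃[ u ] ∃[ u′ ] f u ≡ v × f u′ ≡ w × Adj g u u′

  imageVertex? : Decidable ImageVertex
  imageVertex? v = any? λ u → (f u ≟ v) ×-dec (u ∈? vertices g)

  imageAdj? : ∀ v w → Dec (ImageAdj v w)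
  imageAdj? v w = any? λ u → any? λ u′ → (f u ≟ v) ×-dec (f u′ ≟ w) ×-dec adj? g u u′

  image : Graph n
  image = mkGraph ⟪ imageVertex? ⟫ (tabulate λ v → ⟪ imageAdj? v ⟫)

image-cong : ∀ {n} {f f′ : Fin n → Fin n} → f ≗ f′ → ∀ g → image f g ≡ image f′ g
image-cong {f = f} {f′} f≗f′ g = cong₂ mkGraph
  (⟪⟫-cong (imageVertex? f g) (imageVertex? f′ g) λ v → mk⇔
    (λ (u , p , q) → u , trans (sym (f≗f′ u)) p , q)
    (λ (u , p , q) → u , trans (f≗f′ u) p , q))
  (tabulate-cong λ v → ⟪⟫-cong (imageAdj? f g v) (imageAdj? f′ g v) λ w → mk⇔
    (λ (u , u′ , p , q , a) → u , u′ , trans (sym (f≗f′ u)) p , trans (sym (f≗f′ u′)) q , a)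
    (λ (u , u′ , p , q , a) → u , u′ , trans (f≗f′ u) p , trans (f≗f′ u′) q , a))

image-id : ∀ {n} (g : Graph n) → image (λ v → v) g ≡ g
image-id g = cong₂ mkGraph
  (trans (⟪⟫-cong (imageVertex? _ g) (_∈? vertices g) λ v → mk⇔
           (λ { (_ , refl , v∈) → v∈ }) (λ v∈ → v , refl , v∈))
         (⟪∈⟫ (vertices g)))
  (trans (tabulate-cong λ v → trans
           (⟪⟫-cong (imageAdj? _ g v) (adj? g v) λ w → mk⇔
             (λ { (_ , _ , refl , refl , a) → a }) (λ a → v , w , refl , refl , a))
           (⟪∈⟫ (lookup (neighbours g) v)))
         (tabulate∘lookup (neighbours g)))

adj-image : ∀ {n} (f : Fin n → Fin n) g {v w} → Adj (image f g) v w ⇔ ImageAdj f g v w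
adj-image f g {v} {w} = mk⇔
  (λ a → ∈⟪⟫⁻ (imageAdj? f g v) (subst (w ∈_) row a))
  (λ a → subst (w ∈_) (sym row) (∈⟪⟫⁺ (imageAdj? f g v) a))
  where
  row : lookup (neighbours (image f g)) v ≡ ⟪ imageAdj? f g v ⟫
  row = lookup∘tabulate (λ v → ⟪ imageAdj? f g v ⟫) v

image-∘ : ∀ {n} (f f′ : Fin n → Fin n) g → image f (image f′ g) ≡ image (f ∘ f′) g
image-∘ f f′ g = cong₂ mkGraph
  (⟪⟫-cong (imageVertex? f (image f′ g)) (imageVertex? (f ∘ f′) g) λ v → mk⇔
    (λ (u , p , u∈) → let (x , q , x∈) = ∈⟪⟫⁻ (imageVertex? f′ g) u∈
                      in x , trans (cong f q) p , x∈)
    (λ (x , p , x∈) → f′ x , p , ∈⟪⟫⁺ (imageVertex? f′ g) (x , refl , x∈)))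
  (tabulate-cong λ v →
    ⟪⟫-cong (imageAdj? f (image f′ g) v) (imageAdj? (f ∘ f′) g v) λ w → mk⇔
    (λ (u , u′ , p , p′ , a) →
      let (x , x′ , q , q′ , b) = Equivalence.to (adj-image f′ g) a
      in x , x′ , trans (cong f q) p , trans (cong f q′) p′ , b)
    (λ (x , x′ , p , p′ , b) →
      f′ x , f′ x′ , p , p′ , Equivalence.from (adj-image f′ g) (x , x′ , refl , refl , b)))

------------------------------------------------------------------------
-- Neighbourhoods

-- Within g r i v: the distance from i to v in g is at most r.
Within : ∀ {n} → Graph n → ℕ → Fin n → Fin n → Set
Within g zero    i v = i ≡ v
Within g (suc r) i v = i ≡ v ⊎ (∃[ j ] Adj g i j × Within g r j v)

within? : ∀ {n} (g : Graph n) r i v → Dec (Within g r i v)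
within? g zero    i v = i ≟ v
within? g (suc r) i v = (i ≟ v) ⊎-dec any? λ j → adj? g i j ×-dec within? g r j v

induced : ∀ {n} → Graph n → Subset n → Graph n
induced g W = mkGraph (vertices g ∩ W)
  (tabulate λ u → ⟪ (λ v → (u ∈? W) ×-dec (v ∈? W) ×-dec adj? g u v) ⟫)

U : ∀ {n} → ℕ → Fin n → Graph n → Graph n
U r i g = induced g ⟪ within? g r i ⟫

------------------------------------------------------------------------
-- Local graphs with fixed points 1,…,k

-- The fixed points are the first k elements of Fin n.
fixed : ∀ {k n} .(k≤n : k ≤ n) → Fin k → Fin n
fixed k≤n j = inject≤ j k≤n

module _ {k n} .(k≤n : k ≤ n) where

  Pins : Vec (Fin n) k → (Fin n → Fin n) → Set
  Pins i f = ∀ j → f (fixed k≤n j) ≡ lookup i j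

  Fixes : (Fin n → Fin n) → Set
  Fixes f = ∀ j → f (fixed k≤n j) ≡ fixed k≤n j

  -- The points 1,…,k need not be vertices of a local graph, so maps of
  -- local graphs are taken to be defined on all of {1,…,n}. In particular
  -- an isomorphism fixing 1,…,k extends to a permutation of {1,…,n}.
  Iso : Graph n → Graph n → Set
  Iso g g′ = ∃[ σ ] Fixes (σ ⟨$⟩ʳ_) × image (σ ⟨$⟩ʳ_) g ≡ g′

  iso? : ∀ g g′ → Dec (Iso g g′)
  iso? g g′ = anyPerm? {P = λ f → Fixes f × image f g ≡ g′}
    (λ f≗f′ (fx , e) → (λ j → trans (sym (f≗f′ _)) (fx j))
                     , trans (sym (image-cong f≗f′ g)) e)
    (λ f → all? (λ j → f (fixed k≤n j) ≟ fixed k≤n j) ×-dec (image f g ≟ᴳ g′))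

  iso-refl : ∀ g → Iso g g
  iso-refl g = id , (λ _ → refl) , image-id g

  iso-sym : ∀ g g′ → Iso g g′ → Iso g′ g
  iso-sym g _ (σ , fx , refl) = flip σ
    , (λ j → trans (cong (σ ⟨$⟩ˡ_) (sym (fx j))) (inverseˡ σ))
    , trans (image-∘ (σ ⟨$⟩ˡ_) (σ ⟨$⟩ʳ_) g)
            (trans (image-cong (λ _ → inverseˡ σ) g) (image-id g))

  iso-trans : ∀ g g′ g″ → Iso g g′ → Iso g′ g″ → Iso g g″
  iso-trans g _ _ (σ , fx , refl) (τ , fy , refl) = σ ∘ₚ τ
    , (λ j → trans (cong (τ ⟨$⟩ʳ_) (fx j)) (fy j))
    , sym (image-∘ (τ ⟨$⟩ʳ_) (σ ⟨$⟩ʳ_) g)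

  iso-decSetoid : DecSetoid 0ℓ 0ℓ
  iso-decSetoid = record
    { Carrier = Graph n ; _≈_ = Iso
    ; isDecEquivalence = record
      { isEquivalence = record
        { refl  = λ {g} → iso-refl g
        ; sym   = λ {g g′} → iso-sym g g′
        ; trans = λ {g g′ g″} → iso-trans g g′ g″ }
      ; _≟_ = iso? } }

  IsImage : Graph n → Vec (Fin n) k → Graph n → Set
  IsImage g i s = Σ[ f ∈ (Fin n → Fin n) ] Injective _≡_ _≡_ f × Pins i f × image f g ≡ s

  isImage? : ∀ g i s → Dec (IsImage g i s)
  isImage? g i s = anyMap?
    (λ f≗f′ (inj , pin , e) → (λ {u} {v} → injective-resp f≗f′ inj {u} {v})
                            , (λ j → trans (sym (f≗f′ _)) (pin j))
                            , trans (sym (image-cong f≗f′ g)) e)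
    (λ f → injective? f ×-dec all? (λ j → f (fixed k≤n j) ≟ lookup i j) ×-dec (image f g ≟ᴳ s))

  -- I g h i is the local invariant I_{1,…,k}(g) evaluated at (i₁,…,iₖ) in h.
  I : Graph n → Graph n → Vec (Fin n) k → ℕ
  I g h i = length (filter (λ s → (s ⊑? h) ×-dec isImage? g i s) (graphs n))

  -- Evaluation at (1,…,k).
  I₀ : Graph n → Graph n → ℕ
  I₀ g h = I g h (tabulate (fixed k≤n))

  relabel : Permutation′ k → Fin n → Fin n
  relabel π v with toℕ v <? k
  ... | yes v<k = fixed k≤n (π ⟨$⟩ʳ fromℕ< v<k)
  ... | no  _   = v

⋂U : ∀ {m n} → ℕ → .(suc m ≤ n) → Graph n → Graph n
⋂U r k≤n g = foldr₁ _∩ᴳ_ (tabulate λ j → U r (fixed k≤n j) g)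

-- Membership in ℰ_{1,…,k} for k = suc m, before passing to isomorphism
-- classes.
Local : ∀ {m n} → ℕ → ℕ → .(suc m ≤ n) → Graph n → Set
Local {m} {n} r d k≤n G =
  Σ[ g ∈ Graph n ] Σ[ π ∈ Permutation′ n ]
    Simple g × Spanning g × MaxDegree d g
    × G ≡ ⋂U r k≤n (image (π ⟨$⟩ʳ_) g)

-- A list g₁(1,…,k),…,g_{rₖ}(1,…,k) of the nonempty elements of ℰ_{1,…,k}
-- up to isomorphism fixing 1,…,k, where k = suc m.
record Representatives {m n} (r d : ℕ) .(k≤n : suc m ≤ n) : Set where
  field
    size     : ℕ
    graph    : Fin size → Graph n
    local    : ∀ t → Local r d k≤n (graph t)
    nonempty : ∀ t → Nonempty (vertices (graph t))
    complete : ∀ G → Local r d k≤n G → Nonempty (vertices G) → ∃[ t ] Iso k≤n G (graph t)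
    distinct : ∀ s t → Iso k≤n (graph s) (graph t) → s ≡ t

open Representatives public

local? : ∀ {m n} r d .(k≤n : suc m ≤ n) (G : Graph n) → Dec (Local r d k≤n G)
local? r d k≤n G = anyGraph? λ g → anyPerm?
  {P = λ f → Simple g × Spanning g × MaxDegree d g × G ≡ ⋂U r k≤n (image f g)}
  (λ f≗f′ (s , t , b , e) → s , t , b , trans e (cong (⋂U r k≤n) (image-cong f≗f′ g)))
  (λ f → simple? g ×-dec ≡-dec Bool._≟_ (vertices g) ⊤
         ×-dec all? (λ v → ∣ lookup (neighbours g) v ∣ ≤? d)
         ×-dec (G ≟ᴳ ⋂U r k≤n (image f g)))

representatives : ∀ {m n} r d .(k≤n : suc m ≤ n) → Representatives r d k≤n
representatives {m} {n} r d k≤n = record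
  { size     = length reps
  ; graph    = List.lookup reps
  ; local    = λ t → let (l , _) = good t in l
  ; nonempty = λ t → let (_ , ne) = good t in ne
  ; complete = λ G l ne → let G∈ = covered G (l , ne) in Any.index G∈ , Any.lookup-index G∈
  ; distinct = lookup-distinct (deduplicate-! (iso-decSetoid k≤n) (filter P? (graphs n)))
  }
  where
  P? : (G : Graph n) → Dec (Local r d k≤n G × Nonempty (vertices G))
  P? G = local? r d k≤n G ×-dec nonempty? (vertices G)

  reps : List (Graph n)
  reps = deduplicate (iso? k≤n) (filter P? (graphs n))

  covered : ∀ G → Local r d k≤n G × Nonempty (vertices G) → Any (Iso k≤n G) reps
  covered G pf = Any.deduplicate⁺ (iso? k≤n)
    (λ {x} {y} y≅x G≅x → iso-trans k≤n G x y G≅x (iso-sym k≤n y x y≅x))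
    (Any.map (λ { refl → iso-refl k≤n G }) (∈-filter⁺ P? (∈-graphs G) pf))

  good : ∀ t → Local r d k≤n (List.lookup reps t) × Nonempty (vertices (List.lookup reps t))
  good t = proj₂ (∈-filter⁻ P? {xs = graphs n}
    (∈-deduplicate⁻ (iso? k≤n) (filter P? (graphs n)) (∈-lookup {xs = reps} t)))

  lookup-distinct : ∀ {xs : List (Graph n)} → AllPairs (λ x y → ¬ Iso k≤n x y) xs →
                    ∀ s t → Iso k≤n (List.lookup xs s) (List.lookup xs t) → s ≡ t
  lookup-distinct (_  AllPairs.∷ _)  zero    zero    _ = refl
  lookup-distinct (px AllPairs.∷ _)  zero    (suc t) i = contradiction i (All.lookup px (∈-lookup t))
  lookup-distinct {x List.∷ xs} (px AllPairs.∷ _) (suc s) zero i =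
    contradiction (iso-sym k≤n (List.lookup xs s) x i) (All.lookup px (∈-lookup s))
  lookup-distinct (_  AllPairs.∷ ps) (suc s) (suc t) i = cong suc (lookup-distinct ps s t i)

module _ {m n r d} .{k≤n : suc m ≤ n} (ℰ : Representatives r d k≤n) where

  z : Graph n → Vec (Fin n) (suc m) → Vector ℕ (size ℰ)
  z h i t = I k≤n (graph ℰ t) h i

  E : Matrix ℚ (size ℰ) (size ℰ)
  E a b = I₀ k≤n (graph ℰ b) (graph ℰ a) ↑ℚ

  p : Fin (size ℰ) → Fin (size ℰ) → Vector ℚ (size ℰ)
  p a b t = I₀ k≤n (graph ℰ a) (graph ℰ t) ↑ℚ *ℚ I₀ k≤n (graph ℰ b) (graph ℰ t) ↑ℚ

  -- IsConjugate π x y: y = x^π. The index t′ is unique by `distinct`.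
  IsConjugate : Permutation′ (suc m) → Vector ℕ (size ℰ) → Vector ℕ (size ℰ) → Set
  IsConjugate π x y = ∀ t → ∃[ t′ ]
    Iso k≤n (image (relabel k≤n π) (graph ℰ t)) (graph ℰ t′) × y t ≡ x t′

  -- Identity of functions on all graphs with vertices in {1,…,n}, since E
  -- and p also evaluate the invariants in the local graphs.
  ProductIsLinearCombination : Fin (size ℰ) → Fin (size ℰ) → Set
  ProductIsLinearCombination a b =
    Σ[ c ∈ Vector ℚ (size ℰ) ] ∀ h → Simple h → ∀ i → Unique i →
      z h i a ↑ℚ *ℚ z h i b ↑ℚ ≡ c Linearℚ.∙ (λ t → z h i t ↑ℚ)

-- Passing from fixed points 1,…,k to 1,…,k-1, where k = suc (suc m).
module _ {m n r d} .{k≤n : suc (suc m) ≤ n}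
         (ℰ : Representatives r d k≤n) (ℰ⁻ : Representatives r d (<⇒≤ k≤n)) where

  P : Matrix ℕ (size ℰ) (size ℰ⁻)
  P t u = if does (iso? (<⇒≤ k≤n) (graph ℰ t) (graph ℰ⁻ u)) then 1 else 0

  -- The orbit of k under the stabilizer of graph ℰ t in the permutations
  -- fixing 1,…,k-1.
  orbit : Fin (size ℰ) → Subset n
  orbit t = ⟪ (λ v → anyPerm? {P = Moves v}
      (λ f≗f′ (fx , e , q) → (λ j → trans (sym (f≗f′ _)) (fx j))
                           , trans (sym (image-cong f≗f′ (graph ℰ t))) e
                           , trans (sym (f≗f′ _)) q)
      (λ f → all? (λ j → f (fixed (<⇒≤ k≤n) j) ≟ fixed (<⇒≤ k≤n) j)
             ×-dec (image f (graph ℰ t) ≟ᴳ graph ℰ t)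
             ×-dec (f (fixed k≤n (fromℕ (suc m))) ≟ v))) ⟫
    where
    Moves : Fin n → (Fin n → Fin n) → Set
    Moves v f = Fixes (<⇒≤ k≤n) f × image f (graph ℰ t) ≡ graph ℰ t
                × f (fixed k≤n (fromℕ (suc m))) ≡ v

  D : Matrix ℕ (size ℰ) (size ℰ)
  D = Linearℕ.diag (λ t → ∣ orbit t ∣)

  -- graph ℰ t, with fixed points 1,…,k-1 only, is one of the graph ℰ⁻ u.
  -- This can fail, and then row t of P is zero while z-sum h i t need not
  -- be: if r = 1, d ≥ 2 and g is the path 1 – 3 – 2, then U r 1 g ∩ᴳ U r 2 g
  -- is the single vertex 3, whereas every element of ℰ₁ contains the vertex
  -- 1; and for n ≥ 3 the sum over i₂ of its invariants in a spanning h is (n-1)(n-2).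
  Restricts : Fin (size ℰ) → Set
  Restricts t = ∃[ u ] Iso (<⇒≤ k≤n) (graph ℰ t) (graph ℰ⁻ u)

  z-sum : Graph n → Vec (Fin n) (suc m) → Vector ℕ (size ℰ)
  z-sum h i t = ∑[ v < n ] (if does (v ∈ⱽ? i) then 0 else z ℰ h (i ∷ʳ v) t)
    where
    open SemiringSum +-*-semiring using (sum-syntax)
    open DecMembership (_≟_ {n}) using () renaming (_∈?_ to _∈ⱽ?_)

{-# OPTIONS --safe #-}

-- (i), (ii): relabelling the fixed points by π turns an image of g^π pinned at i into an image of
-- g pinned at i ∘ π. If s ⊆ h is the image of g under f₀ pinned at i₁,…,iₖ₋₁, then all such
-- maps onto s are the f₀ ∘ σ with σ in the stabilizer of g, so the values they take at k form
-- the f₀-image of the orbit of k; count the pairs (s , iₖ) in two ways.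
--
-- (iii): an entry E a b ≠ 0 means that g_b embeds in g_a, hence a = b or g_b has smaller weight
-- (number of vertices plus sum of degrees); since E a a = 1, E is unitriangular. Evaluating a
-- linear combination z_a z_b = c ∙ z in the local graphs themselves gives p = E c.

module Submission where

open import Defs
open import Algebra.Bundles using (Semiring; CommutativeRing)
import Algebra.Properties.Semiring.Sum as SemiringSum
open import Data.Bool.Base using (true; false; if_then_else_)
open import Data.Bool.Properties using (⇔→≡)
open import Data.Fin.Base using (Fin; zero; suc; toℕ; fromℕ; inject₁; punchOut)
open import Data.Fin.Permutation as Perm
  using (Permutation′; permutation; _⟨$⟩ʳ_; _⟨$⟩ˡ_; inverseˡ; inverseʳ; _∘ₚ_)
open import Data.Fin.Properties
  using ( _≟_; any?; all?; suc-injective; toℕ<n; toℕ-fromℕ<; toℕ-inject≤; toℕ-inject₁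
        ; toℕ-injective; inject≤-injective; fromℕ≢inject₁; injective⇒≤; punchOut-injective)
open import Data.Fin.Relation.Unary.Top using (view; ‵fromℕ; ‵inject₁)
open import Data.Fin.Subset using (Subset; _∈_; _⊆_; ∣_∣)
open import Data.Fin.Subset.Properties
  using ( _∈?_; ⊆-antisym; p⊆q⇒∣p∣≤∣q∣; p⊂q⇒∣p∣<∣q∣; x∈p∩q⁺; x∈p∩q⁻
        ; Empty-unique; ∣⊥∣≡0)
open import Data.List.Base as List using (List; length; filter)
open import Data.List.Membership.Propositional using () renaming (_∈_ to _∈ᴸ_)
open import Data.List.Properties using (filter-≐; filter-none; filter-accept; filter-reject)
import Data.List.Relation.Unary.All as All
import Data.List.Relation.Unary.AllPairs as AllPairs
open import Data.List.Relation.Unary.Any using (here; there)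
import Data.List.Relation.Unary.Unique.Propositional as List
open import Data.List.Relation.Unary.Unique.Propositional.Properties using (cartesianProductWith⁺)
open import Data.Nat.Base as ℕ using (ℕ; zero; suc; _≤_)
import Data.Nat.Properties as ℕ
open import Data.Nat.Properties using (<⇒≤)
open import Data.Product.Base using (∃-syntax; _×_; _,_; proj₁; proj₂)
open import Data.Rational.Base using () renaming (_*_ to _*ℚ_)
import Data.Rational.Properties as ℚ
open import Data.Sum.Base using (inj₁; inj₂)
open import Data.Vec.Base using (Vec; []; _∷_; lookup; tabulate; foldr₁; _∷ʳ_)
open import Data.Vec.Functional using (Vector)
import Data.Vec.Membership.DecPropositional as DecMembership
open import Data.Vec.Membership.Propositional using () renaming (_∈_ to _∈ⱽ_)
open import Data.Vec.Properties
  using ( tabulate-cong; lookup∘tabulate; tabulate∘lookup; []=⇒lookup; lookup⇒[]=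
        ; lookup-zipWith; ∷-injective)
open import Data.Vec.Relation.Unary.Any using (index)
open import Data.Vec.Relation.Unary.Any.Properties using (lookup-index)
open import Data.Vec.Relation.Unary.Unique.Propositional using (Unique)
open import Data.Vec.Relation.Unary.Unique.Propositional.Properties using (tabulate⁺)
open import Function.Base using (_∘_; flip)
open import Function.Bundles using (_⇔_; mk⇔; module Equivalence)
open import Function.Definitions using (Injective)
open import Relation.Binary.PropositionalEquality as ≡ using (_≡_; _≢_; _≗_; module ≡-Reasoning)
open import Relation.Nullary using (¬_; does; yes; no; contradiction)
open import Relation.Nullary.Decidable using (_×-dec_; dec-true; dec-false)
open import Relation.Unary using (Pred; Decidable)

-- Linear algebra

module SemiringLemmas {c ℓ} (R : Semiring c ℓ) where
  open Semiring R hiding (zero)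
  open SemiringSum R
  open Linear R
  open import Relation.Binary.Reasoning.Setoid setoid

  sum-zero : ∀ {n} {f : Vector Carrier n} → (∀ i → f i ≈ 0#) → sum f ≈ 0#
  sum-zero {n} f≈0 = trans (sum-cong-≋ f≈0) (sum-replicate-zero n)

  sum-single : ∀ {n} (f : Vector Carrier n) i → (∀ j → j ≢ i → f j ≈ 0#) → sum f ≈ f i
  sum-single f zero    f≈0 =
    trans (+-congˡ (sum-zero λ j → f≈0 (suc j) λ ())) (+-identityʳ _)
  sum-single f (suc i) f≈0 = trans (+-congʳ (f≈0 zero λ ())) (trans (+-identityˡ _)
    (sum-single (f ∘ suc) i λ j j≢i → f≈0 (suc j) (j≢i ∘ suc-injective)))

  diag-≡ : ∀ {n} (d : Vector Carrier n) i → diag d i i ≡ d i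
  diag-≡ d i with i ≟ i
  ... | yes _   = ≡.refl
  ... | no  i≢i = contradiction ≡.refl i≢i

  diag-≢ : ∀ {n} (d : Vector Carrier n) {i j} → i ≢ j → diag d i j ≡ 0#
  diag-≢ d {i} {j} i≢j with i ≟ j
  ... | yes i≡j = contradiction i≡j i≢j
  ... | no  _   = ≡.refl

  diag-·ⱽ : ∀ {n} (d x : Vector Carrier n) i → (diag d ·ⱽ x) i ≈ d i * x i
  diag-·ⱽ d x i = trans
    (sum-single _ i λ j j≢i → trans (*-congʳ (reflexive (diag-≢ d (j≢i ∘ ≡.sym)))) (zeroˡ _))
    (*-congʳ (reflexive (diag-≡ d i)))

  1ᴹ-·ⱽ : ∀ {n} (x : Vector Carrier n) i → (1ᴹ ·ⱽ x) i ≈ x i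
  1ᴹ-·ⱽ x i = trans (diag-·ⱽ _ x i) (*-identityˡ _)

  ·ᴹ-1ᴹ : ∀ {m n} (A : Matrix Carrier m n) i j → (A ·ᴹ 1ᴹ) i j ≈ A i j
  ·ᴹ-1ᴹ A i j = trans
    (sum-single _ j λ k k≢j → trans (*-congˡ (reflexive (diag-≢ _ k≢j))) (zeroʳ _))
    (trans (*-congˡ (reflexive (diag-≡ _ j))) (*-identityʳ _))

  ·ⱽ-congˡ : ∀ {m n} (A : Matrix Carrier m n) {x y : Vector Carrier n} →
             (∀ j → x j ≈ y j) → ∀ i → (A ·ⱽ x) i ≈ (A ·ⱽ y) i
  ·ⱽ-congˡ A x≈y i = sum-cong-≋ λ j → *-congˡ (x≈y j)

  ·ⱽ-congʳ : ∀ {m n} {A B : Matrix Carrier m n} (x : Vector Carrier n) →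
             (∀ i j → A i j ≈ B i j) → ∀ i → (A ·ⱽ x) i ≈ (B ·ⱽ x) i
  ·ⱽ-congʳ x A≈B i = sum-cong-≋ λ j → *-congʳ (A≈B i j)

  -- Interchange of the two summations. A column of `A ·ᴹ B` is by definition `A ·ⱽ` the
  -- corresponding column of `B`, so taking `x` to be a column also gives associativity of `·ᴹ`.
  ·ⱽ-assoc : ∀ {m n o} (A : Matrix Carrier m n) (B : Matrix Carrier n o) x i →
             ((A ·ᴹ B) ·ⱽ x) i ≈ (A ·ⱽ (B ·ⱽ x)) i
  ·ⱽ-assoc {n = n} {o} A B x i = begin
    ∑[ k < o ] (∑[ j < n ] (A i j * B j k) * x k)
      ≈⟨ sum-cong-≋ (λ k → *-distribʳ-sum (x k) (λ j → A i j * B j k)) ⟩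
    ∑[ k < o ] ∑[ j < n ] (A i j * B j k * x k)
      ≈⟨ ∑-comm (λ k j → A i j * B j k * x k) ⟩
    ∑[ j < n ] ∑[ k < o ] (A i j * B j k * x k)
      ≈⟨ sum-cong-≋ (λ j → sum-cong-≋ λ k → *-assoc (A i j) (B j k) (x k)) ⟩
    ∑[ j < n ] ∑[ k < o ] (A i j * (B j k * x k))
      ≈⟨ sum-cong-≋ (λ j → *-distribˡ-sum (A i j) (λ k → B j k * x k)) ⟨
    ∑[ j < n ] (A i j * ∑[ k < o ] (B j k * x k)) ∎

  inverse-solves : ∀ {n} (A B : Matrix Carrier n n) → IsInverse A B →
                   ∀ {x y} → (∀ i → (A ·ⱽ x) i ≈ y i) → ∀ i → x i ≈ (B ·ⱽ y) i
  inverse-solves A B (_ , BA≈1) {x} {y} Ax≈y i = begin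
    x i                  ≈⟨ 1ᴹ-·ⱽ x i ⟨
    (1ᴹ ·ⱽ x) i          ≈⟨ ·ⱽ-congʳ x BA≈1 i ⟨
    ((B ·ᴹ A) ·ⱽ x) i    ≈⟨ ·ⱽ-assoc B A x i ⟩
    (B ·ⱽ (A ·ⱽ x)) i    ≈⟨ ·ⱽ-congˡ B Ax≈y i ⟩
    (B ·ⱽ y) i           ∎

  -- The chain `C = C (A B) = (C A) B = B` identifies the two one-sided inverses.
  left-right-inverse : ∀ {n} {A B C : Matrix Carrier n n} →
    (∀ i j → (C ·ᴹ A) i j ≈ 1ᴹ i j) → (∀ i j → (A ·ᴹ B) i j ≈ 1ᴹ i j) → IsInverse A B
  left-right-inverse {A = A} {B} {C} CA≈1 AB≈1 = AB≈1 , λ i j → trans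
    (·ⱽ-congʳ (λ k → A k j) (λ i j → sym (C≈B i j)) i) (CA≈1 i j)
    where
    C≈B : ∀ i j → C i j ≈ B i j
    C≈B i j = begin
      C i j                ≈⟨ ·ᴹ-1ᴹ C i j ⟨
      (C ·ᴹ 1ᴹ) i j        ≈⟨ ·ⱽ-congˡ C (λ k → AB≈1 k j) i ⟨
      (C ·ᴹ (A ·ᴹ B)) i j  ≈⟨ ·ⱽ-assoc C A (λ k → B k j) i ⟨
      ((C ·ᴹ A) ·ᴹ B) i j  ≈⟨ ·ⱽ-congʳ (λ k → B k j) CA≈1 i ⟩
      (1ᴹ ·ᴹ B) i j        ≈⟨ 1ᴹ-·ⱽ (λ k → B k j) i ⟩
      B i j                ∎

-- Inverting unitriangular matrices

private module ∑ℕ = SemiringSum ℕ.+-*-semiring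

lookup≤sum : ∀ {n} (f : Vector ℕ n) i → f i ℕ.≤ ∑ℕ.sum f
lookup≤sum f zero    = ℕ.m≤m+n _ _
lookup≤sum f (suc i) = ℕ.≤-trans (lookup≤sum (f ∘ suc) i) (ℕ.m≤n+m _ _)

module Unitriangular {c ℓ} (R : CommutativeRing c ℓ) where
  open CommutativeRing R hiding (zero)
  open SemiringSum semiring
  open Linear semiring
  open SemiringLemmas semiring
  open import Relation.Binary.Reasoning.Setoid setoid

  -- The weight `w` takes the place of an ordering of the indices: listing them by increasing weight
  -- makes `A` lower triangular with ones on the diagonal. Distinct indices of equal weight have
  -- entry zero.
  record IsUnitriangular {n} (w : Fin n → ℕ) (A : Matrix Carrier n n) : Set ℓ where
    field
      diagonal : ∀ i → A i i ≈ 1#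
      zeros    : ∀ i j → i ≢ j → ¬ w j ℕ.< w i → A i j ≈ 0#

  open IsUnitriangular

  module _ {n} {w : Fin n → ℕ} {A : Matrix Carrier n n} (A-unitri : IsUnitriangular w A) where

    strict : Matrix Carrier n n
    strict i j = if does (w j ℕ.<? w i) then A i j else 0#

    strict-< : ∀ {i j} → w j ℕ.< w i → strict i j ≡ A i j
    strict-< {i} {j} wj<wi =
      ≡.cong (if_then A i j else 0#) (dec-true (w j ℕ.<? w i) wj<wi)

    strict-≮ : ∀ {i j} → ¬ w j ℕ.< w i → strict i j ≡ 0#
    strict-≮ {i} {j} wj≮wi =
      ≡.cong (if_then A i j else 0#) (dec-false (w j ℕ.<? w i) wj≮wi)

    A≈1+strict : ∀ i j → A i j ≈ 1ᴹ i j + strict i j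
    A≈1+strict i j with i ≟ j | w j ℕ.<? w i
    ... | yes ≡.refl | _ = trans (diagonal A-unitri i)
      (sym (trans (+-congˡ (reflexive (strict-≮ (ℕ.<-irrefl ≡.refl)))) (+-identityʳ _)))
    ... | no  _      | yes wj<wi =
      sym (trans (+-congˡ (reflexive (strict-< wj<wi))) (+-identityˡ _))
    ... | no  i≢j    | no  wj≮wi = trans (zeros A-unitri i j i≢j wj≮wi)
      (sym (trans (+-congˡ (reflexive (strict-≮ wj≮wi))) (+-identityˡ _)))

    -- Every entry of row `i` in a column of weight at least `w i` is zero. This is what lets the
    -- system be solved in order of increasing weight.
    strict-·ⱽ-cong : ∀ {x y} i → (∀ j → w j ℕ.< w i → x j ≈ y j) →
                     (strict ·ⱽ x) i ≈ (strict ·ⱽ y) i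
    strict-·ⱽ-cong {x} {y} i x≈y = sum-cong-≋ entry
      where
      entry : ∀ j → strict i j * x j ≈ strict i j * y j
      entry j with w j ℕ.<? w i
      ... | yes wj<wi = *-congˡ (x≈y j wj<wi)
      ... | no  wj≮wi = trans (annihilated (x j)) (sym (annihilated (y j)))
        where
        annihilated : ∀ a → strict i j * a ≈ 0#
        annihilated a = trans (*-congʳ (reflexive (strict-≮ wj≮wi))) (zeroˡ a)

    A-·ⱽ : ∀ x i → (A ·ⱽ x) i ≈ x i + (strict ·ⱽ x) i
    A-·ⱽ x i = begin
      (A ·ⱽ x) i
        ≈⟨ sum-cong-≋ (λ j → trans (*-congʳ (A≈1+strict i j)) (distribʳ (x j) _ _)) ⟩
      ∑[ j < n ] (1ᴹ i j * x j + strict i j * x j)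
        ≈⟨ ∑-distrib-+ (λ j → 1ᴹ i j * x j) (λ j → strict i j * x j) ⟩
      (1ᴹ ·ⱽ x) i + (strict ·ⱽ x) i
        ≈⟨ +-congʳ (1ᴹ-·ⱽ x i) ⟩
      x i + (strict ·ⱽ x) i ∎

    -- Substitution: after k steps the coordinates of weight less than k are final.
    solve : Vector Carrier n → ℕ → Vector Carrier n
    solve y zero    i = 0#
    solve y (suc k) i = y i - (strict ·ⱽ solve y k) i

    solve-stable : ∀ y k i → w i ℕ.< k → solve y (suc k) i ≈ solve y k i
    solve-stable y (suc k) i wi<1+k = +-congˡ (-‿cong (strict-·ⱽ-cong i λ j wj<wi →
      solve-stable y k j (ℕ.<-≤-trans wj<wi (ℕ.s≤s⁻¹ wi<1+k))))

    -- With `A = 1 + strict`, the last step has subtracted `strict ·ⱽ solve y k`, while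
    -- `strict ·ⱽ solve y (suc k)` is added back. Row `i` sees only coordinates that are already
    -- final, so the two cancel.
    A-·ⱽ-solve : ∀ y k i → w i ℕ.< k → (A ·ⱽ solve y k) i ≈ y i
    A-·ⱽ-solve y (suc k) i wi<1+k = begin
      (A ·ⱽ solve y (suc k)) i
        ≈⟨ A-·ⱽ _ i ⟩
      y i - (strict ·ⱽ solve y k) i + (strict ·ⱽ solve y (suc k)) i
        ≈⟨ +-congˡ (strict-·ⱽ-cong i λ j wj<wi →
             solve-stable y k j (ℕ.<-≤-trans wj<wi (ℕ.s≤s⁻¹ wi<1+k))) ⟩
      y i - (strict ·ⱽ solve y k) i + (strict ·ⱽ solve y k) i
        ≈⟨ +-assoc _ _ _ ⟩
      y i + (- (strict ·ⱽ solve y k) i + (strict ·ⱽ solve y k) i)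
        ≈⟨ +-congˡ (-‿inverseˡ _) ⟩
      y i + 0#
        ≈⟨ +-identityʳ _ ⟩
      y i ∎

    rightInverse : ∃[ B ] ∀ i j → (A ·ᴹ B) i j ≈ 1ᴹ i j
    -- Column `j` solves the system for the `j`-th unit vector. The sum of all weights bounds each
    -- of them, so one step more makes every coordinate final.
    rightInverse = (λ i j → solve (λ k → 1ᴹ k j) (suc (∑ℕ.sum w)) i)
      , λ i j → A-·ⱽ-solve (λ k → 1ᴹ k j) (suc (∑ℕ.sum w)) i (ℕ.s≤s (lookup≤sum w i))

  -- Transposition reverses the order of the weights, as does subtracting them from their total. No
  -- weight exceeds the total, so truncated subtraction stays strictly decreasing.
  transpose-unitriangular : ∀ {n} {w : Fin n → ℕ} {A} → IsUnitriangular w A →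
                            IsUnitriangular (λ i → ∑ℕ.sum w ℕ.∸ w i) (flip A)
  transpose-unitriangular {w = w} A-unitri = record
    { diagonal = diagonal A-unitri
    ; zeros    = λ i j i≢j w′j≮w′i → zeros A-unitri j i (i≢j ∘ ≡.sym) λ wi<wj →
        w′j≮w′i (ℕ.∸-monoʳ-< wi<wj (lookup≤sum w j))
    }

  1ᴹ-sym : ∀ {n} (i j : Fin n) → 1ᴹ i j ≡ 1ᴹ j i
  1ᴹ-sym i j with i ≟ j
  ... | yes ≡.refl = ≡.sym (diag-≡ _ i)
  ... | no  i≢j    = ≡.sym (diag-≢ _ (i≢j ∘ ≡.sym))

  -- Substitution yields only right inverses; a right inverse of the transpose, transposed back, is
  -- a left inverse because multiplication commutes.
  unitriangular⇒invertible : ∀ {n} {w : Fin n → ℕ} {A} → IsUnitriangular w A →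
                             ∃[ B ] IsInverse A B
  unitriangular⇒invertible {A = A} A-unitri =
    let B , AB≈1   = rightInverse A-unitri
        C , AᵀC≈1 = rightInverse (transpose-unitriangular A-unitri)
    in B , left-right-inverse {C = flip C}
      (λ i j → trans (sum-cong-≋ λ k → *-comm (C k i) (A k j))
                     (trans (AᵀC≈1 j i) (reflexive (1ᴹ-sym j i))))
      AB≈1

open ≡ using (refl; sym; trans; cong; cong₂; subst)
open ∑ℕ using (sum; sum-cong-≗; sum-permute; ∑-distrib-+)
private
  module ℕ-sum = SemiringLemmas ℕ.+-*-semiring
  module ℚ-sum where
    open SemiringSum (CommutativeRing.semiring ℚ.+-*-commutativeRing) public
    open SemiringLemmas (CommutativeRing.semiring ℚ.+-*-commutativeRing) public
open Unitriangular ℚ.+-*-commutativeRing using (IsUnitriangular; unitriangular⇒invertible)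

-- Permutations, cardinalities and sums over finite sets

private variable
  k m n : ℕ

-- Pigeonhole: if `v` were missed, punching it out of the codomain would leave an injection from
-- `suc n` points into `n`.
injective⇒surjective : ∀ {f : Fin n → Fin n} → Injective _≡_ _≡_ f → ∀ v → ∃[ u ] f u ≡ v
injective⇒surjective {suc n} {f} inj v with any? (λ u → f u ≟ v)
... | yes u,fu≡v = u,fu≡v
... | no  v∉f    = contradiction
  (injective⇒≤ {f = λ u → punchOut (v≢f u)}
    λ eq → inj (punchOut-injective (v≢f _) (v≢f _) eq))
  ℕ.1+n≰n
  where
  v≢f : ∀ u → v ≢ f u
  v≢f u v≡fu = v∉f (u , sym v≡fu)

-- The forward map is definitionally `f`, so lemmas about permutations apply directly to the maps in
-- `IsImage`.
injective⇒permutation : (f : Fin n → Fin n) → Injective _≡_ _≡_ f → Permutation′ n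
injective⇒permutation f inj = permutation f (proj₁ ∘ surj) (proj₂ ∘ surj)
  (λ u → inj (proj₂ (surj (f u))))
  where surj = injective⇒surjective inj

perm-injective : ∀ (σ : Permutation′ n) → Injective _≡_ _≡_ (σ ⟨$⟩ʳ_)
perm-injective σ eq = trans (sym (inverseˡ σ)) (trans (cong (σ ⟨$⟩ˡ_) eq) (inverseˡ σ))

∣p∣≡∑ : ∀ (p : Subset n) → ∣ p ∣ ≡ sum (λ v → if lookup p v then 1 else 0)
∣p∣≡∑ []          = refl
∣p∣≡∑ (true  ∷ p) = cong suc (∣p∣≡∑ p)
∣p∣≡∑ (false ∷ p) = ∣p∣≡∑ p

-- Both cardinalities are sums of indicators, and `σ` reindexes one sum into the other.
∣∣-permute : ∀ (σ : Permutation′ n) {p q : Subset n} →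
             (∀ v → v ∈ p ⇔ σ ⟨$⟩ʳ v ∈ q) → ∣ p ∣ ≡ ∣ q ∣
∣∣-permute σ {p} {q} p⇔q = trans (∣p∣≡∑ p) (trans
  (sum-cong-≗ λ v → cong (if_then 1 else 0) (⇔→≡ (mk⇔
    (λ eq → []=⇒lookup (Equivalence.to (p⇔q v) (lookup⇒[]= v p eq)))
    (λ eq → []=⇒lookup (Equivalence.from (p⇔q v) (lookup⇒[]= _ q eq))))))
  (sym (trans (∣p∣≡∑ q) (sum-permute _ σ))))

sum-mono-≤ : ∀ {f g : Vector ℕ n} → (∀ i → f i ℕ.≤ g i) → sum f ℕ.≤ sum g
sum-mono-≤ {zero}  f≤g = ℕ.z≤n
sum-mono-≤ {suc n} f≤g = ℕ.+-mono-≤ (f≤g zero) (sum-mono-≤ (f≤g ∘ suc))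

+-≤-tight : ∀ {a b c d} → a ℕ.≤ b → c ℕ.≤ d → a ℕ.+ c ≡ b ℕ.+ d → a ≡ b × c ≡ d
+-≤-tight {a} {b} {c} {d} a≤b c≤d eq =
  a≡b , ℕ.+-cancelˡ-≡ b c d (trans (cong (ℕ._+ c) (sym a≡b)) eq)
  where
  a≡b : a ≡ b
  a≡b = ℕ.≤-antisym a≤b (ℕ.+-cancelʳ-≤ d b a
    (ℕ.≤-trans (ℕ.≤-reflexive (sym eq)) (ℕ.+-monoʳ-≤ a c≤d)))

sum-≤-tight : ∀ {f g : Vector ℕ n} → (∀ i → f i ℕ.≤ g i) → sum f ≡ sum g → f ≗ g
sum-≤-tight f≤g eq zero    = proj₁ (+-≤-tight (f≤g zero) (sum-mono-≤ (f≤g ∘ suc)) eq)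
sum-≤-tight f≤g eq (suc i) = sum-≤-tight (f≤g ∘ suc)
  (proj₂ (+-≤-tight (f≤g zero) (sum-mono-≤ (f≤g ∘ suc)) eq)) i

⊆∧∣∣≡⇒≡ : ∀ {p q : Subset n} → p ⊆ q → ∣ p ∣ ≡ ∣ q ∣ → p ≡ q
⊆∧∣∣≡⇒≡ {p = p} {q} p⊆q ∣p∣≡∣q∣ = ⊆-antisym p⊆q q⊆p
  where
  q⊆p : q ⊆ p
  q⊆p {v} v∈q with v ∈? p
  ... | yes v∈p = v∈p
  ... | no  v∉p = contradiction ∣p∣≡∣q∣ (ℕ.<⇒≢ (p⊂q⇒∣p∣<∣q∣ (p⊆q , v , v∈q , v∉p)))

-- Subgraphs and images

rows-≡ : ∀ {g h : Graph n} → vertices g ≡ vertices h →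
         (∀ u → lookup (neighbours g) u ≡ lookup (neighbours h) u) → g ≡ h
rows-≡ {g = g} {h} V≡ N≡ = cong₂ mkGraph V≡ (trans (sym (tabulate∘lookup (neighbours g)))
  (trans (tabulate-cong N≡) (tabulate∘lookup (neighbours h))))

infix 4 _≼_

-- _⊑_ as a record, since the two graphs cannot be inferred from the unfolded inclusions.
record _≼_ {n} (s h : Graph n) : Set where
  constructor ⟨_⟩
  field inclusion : s ⊑ h

open _≼_

≼-antisym : ∀ {g h : Graph n} → g ≼ h → h ≼ g → g ≡ h
≼-antisym ⟨ V⊆ , N⊆ ⟩ ⟨ V⊇ , N⊇ ⟩ = rows-≡ (⊆-antisym V⊆ V⊇) λ u → ⊆-antisym (N⊆ u) (N⊇ u)

≼-refl : ∀ {g : Graph n} → g ≼ g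
≼-refl = ⟨ (λ v∈ → v∈) , (λ _ a → a) ⟩

weight : Graph n → ℕ
weight g = ∣ vertices g ∣ ℕ.+ sum (λ u → ∣ lookup (neighbours g) u ∣)

≼⇒weight≤ : ∀ {s g : Graph n} → s ≼ g → weight s ℕ.≤ weight g
≼⇒weight≤ ⟨ V⊆ , N⊆ ⟩ = ℕ.+-mono-≤ (p⊆q⇒∣p∣≤∣q∣ V⊆) (sum-mono-≤ λ u → p⊆q⇒∣p∣≤∣q∣ (N⊆ u))

-- The vertex set and each row of `s` are no larger than those of `g`. Equal totals leave no slack
-- in any of these inequalities, so every inclusion is an equality.
≼∧weight≡⇒≡ : ∀ {s g : Graph n} → s ≼ g → weight s ≡ weight g → s ≡ g
≼∧weight≡⇒≡ {s = s} {g} ⟨ V⊆ , N⊆ ⟩ eq =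
  rows-≡ (⊆∧∣∣≡⇒≡ V⊆ V≡) λ u → ⊆∧∣∣≡⇒≡ (N⊆ u) (sum-≤-tight N≤ N≡ u)
  where
  N≤ = λ u → p⊆q⇒∣p∣≤∣q∣ (N⊆ u)
  split = +-≤-tight (p⊆q⇒∣p∣≤∣q∣ V⊆) (sum-mono-≤ N≤) eq
  V≡ = proj₁ split
  N≡ = proj₂ split

module _ (f : Fin n → Fin n) where

  vertex-image⁺ : ∀ (g : Graph n) {u} → u ∈ vertices g → f u ∈ vertices (image f g)
  vertex-image⁺ g u∈ = ∈⟪⟫⁺ (imageVertex? f g) (_ , refl , u∈)

  adj-image⁺ : ∀ (g : Graph n) {u v} → Adj g u v → Adj (image f g) (f u) (f v)
  adj-image⁺ g a = Equivalence.from (adj-image f g) (_ , _ , refl , refl , a)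

  module _ (inj : Injective _≡_ _≡_ f) where

    vertex-image⁻ : ∀ (g : Graph n) {u} → f u ∈ vertices (image f g) → u ∈ vertices g
    vertex-image⁻ g fu∈ with ∈⟪⟫⁻ (imageVertex? f g) fu∈
    ... | _ , fx≡fu , x∈ = subst (_∈ vertices g) (inj fx≡fu) x∈

    adj-image⁻ : ∀ (g : Graph n) {u v} → Adj (image f g) (f u) (f v) → Adj g u v
    adj-image⁻ g a with Equivalence.to (adj-image f g) a
    ... | _ , _ , fx≡fu , fy≡fv , b with inj fx≡fu | inj fy≡fv
    ... | refl | refl = b

  image-≼ : ∀ (g h : Graph n) → (∀ {u} → u ∈ vertices g → f u ∈ vertices h) →
            (∀ {u v} → Adj g u v → Adj h (f u) (f v)) → image f g ≼ h
  image-≼ g h V N =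
    ⟨ (λ v∈ → let (_ , eq , u∈) = ∈⟪⟫⁻ (imageVertex? f g) v∈ in subst (_∈ vertices h) eq (V u∈))
    , (λ _ a → adj (Equivalence.to (adj-image f g) a)) ⟩
    where
    adj : ∀ {v w} → ImageAdj f g v w → Adj h v w
    adj (_ , _ , refl , refl , a) = N a

  image-mono : ∀ {g h : Graph n} → g ≼ h → image f g ≼ image f h
  image-mono {g} {h} ⟨ V⊆ , N⊆ ⟩ = image-≼ g (image f h)
    (λ u∈ → vertex-image⁺ h (V⊆ u∈)) (λ a → adj-image⁺ h (N⊆ _ a))

  image-simple : Injective _≡_ _≡_ f → ∀ {g} → Simple g → Simple (image f g)
  image-simple inj {g} g-simple = record
    { incident    = λ a → inc (Equivalence.to (adj-image f g) a)
    ; symmetric   = λ a → symm (Equivalence.to (adj-image f g) a)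
    ; irreflexive = λ a → irr (Equivalence.to (adj-image f g) a)
    }
    where
    open Simple g-simple
    inc : ∀ {v w} → ImageAdj f g v w → v ∈ vertices (image f g)
    inc (_ , _ , refl , _ , a) = vertex-image⁺ g (incident a)
    symm : ∀ {v w} → ImageAdj f g v w → Adj (image f g) w v
    symm (_ , _ , refl , refl , a) = adj-image⁺ g (symmetric a)
    irr : ∀ {v} → ¬ ImageAdj f g v v
    irr (_ , _ , p , q , a) with inj (trans p (sym q))
    ... | refl = irreflexive a

image-inverse : ∀ {f f′ : Fin n → Fin n} → f ∘ f′ ≗ (λ v → v) → ∀ g → image f (image f′ g) ≡ g
image-inverse {f = f} {f′} ff′≗id g =
  trans (image-∘ f f′ g) (trans (image-cong ff′≗id g) (image-id g))

-- The permutation maps the vertex set bijectively onto that of the image, and row `u` onto row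
-- `f u`; the sum over rows is reindexed by `σ`.
weight-image : ∀ (σ : Permutation′ n) g → weight (image (σ ⟨$⟩ʳ_) g) ≡ weight g
weight-image σ g = sym (cong₂ ℕ._+_
  (∣∣-permute σ λ v → mk⇔ (vertex-image⁺ f g) (vertex-image⁻ f inj g))
  (trans (sum-cong-≗ λ u → ∣∣-permute σ {row g u} {row (image f g) (f u)} λ v →
           mk⇔ (adj-image⁺ f g) (adj-image⁻ f inj g))
         (sym (sum-permute (∣_∣ ∘ row (image f g)) σ))))
  where
  f = σ ⟨$⟩ʳ_
  row : Graph _ → Fin _ → Subset _
  row g = lookup (neighbours g)
  inj : Injective _≡_ _≡_ f
  inj = perm-injective σ

-- Neighbourhoods

module _ (g : Graph n) (W : Subset n) where

  inside? : ∀ u → Decidable λ v → u ∈ W × v ∈ W × Adj g u v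
  inside? u v = (u ∈? W) ×-dec (v ∈? W) ×-dec adj? g u v

  adj-induced⁺ : ∀ {u v} → u ∈ W → v ∈ W → Adj g u v → Adj (induced g W) u v
  adj-induced⁺ {u} {v} u∈ v∈ a =
    subst (v ∈_) (sym (lookup∘tabulate _ u)) (∈⟪⟫⁺ (inside? u) (u∈ , v∈ , a))

  adj-induced⁻ : ∀ {u v} → Adj (induced g W) u v → u ∈ W × v ∈ W × Adj g u v
  adj-induced⁻ {u} {v} a = ∈⟪⟫⁻ (inside? u) (subst (v ∈_) (lookup∘tabulate _ u) a)

within-image : ∀ (f : Fin n → Fin n) g r {i v} → Within g r i v → Within (image f g) r (f i) (f v)
within-image f g zero    refl                 = refl
within-image f g (suc r) (inj₁ refl)          = inj₁ refl
within-image f g (suc r) (inj₂ (j , a , w)) = inj₂ (f j , adj-image⁺ f g a , within-image f g r w)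

-- A path from `i` is carried to a walk of the same length from `f i`. For relabellings the reverse
-- inclusion comes later, from the inverse map.
image-U-≼ : ∀ (f : Fin n → Fin n) r i g → image f (U r i g) ≼ U r (f i) (image f g)
image-U-≼ f r i g = image-≼ f (U r i g) (U r (f i) (image f g))
  (λ u∈ → let (u∈g , u∈W) = x∈p∩q⁻ _ _ u∈ in x∈p∩q⁺ (vertex-image⁺ f g u∈g , near u∈W))
  (λ a → let (u∈W , v∈W , b) = adj-induced⁻ g _ a
         in adj-induced⁺ (image f g) _ (near u∈W) (near v∈W) (adj-image⁺ f g b))
  where
  near : ∀ {u} → u ∈ ⟪ within? g r i ⟫ → f u ∈ ⟪ within? (image f g) r (f i) ⟫
  near u∈ = ∈⟪⟫⁺ (within? (image f g) r (f i)) (within-image f g r (∈⟪⟫⁻ (within? g r i) u∈))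

induced-simple : ∀ {g : Graph n} → Simple g → ∀ W → Simple (induced g W)
induced-simple {g = g} g-simple W = record
  { incident    = λ a → let (u∈ , _ , b) = adj-induced⁻ g W a in x∈p∩q⁺ (incident b , u∈)
  ; symmetric   = λ a → let (u∈ , v∈ , b) = adj-induced⁻ g W a
                        in adj-induced⁺ g W v∈ u∈ (symmetric b)
  ; irreflexive = λ a → let (_ , _ , b) = adj-induced⁻ g W a in irreflexive b
  }
  where open Simple g-simple

module _ (g h : Graph n) where

  adj-∩⁺ : ∀ {u v} → Adj g u v → Adj h u v → Adj (g ∩ᴳ h) u v
  adj-∩⁺ {u} {v} a b =
    subst (v ∈_) (sym (lookup-zipWith _ u (neighbours g) (neighbours h))) (x∈p∩q⁺ (a , b))

  adj-∩⁻ : ∀ {u v} → Adj (g ∩ᴳ h) u v → Adj g u v × Adj h u v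
  adj-∩⁻ {u} {v} a =
    x∈p∩q⁻ _ _ (subst (v ∈_) (lookup-zipWith _ u (neighbours g) (neighbours h)) a)

  ∩-simple : Simple g → Simple h → Simple (g ∩ᴳ h)
  ∩-simple g-simple h-simple = record
    { incident    = λ a → let (b , c) = adj-∩⁻ a in x∈p∩q⁺ (G.incident b , H.incident c)
    ; symmetric   = λ a → let (b , c) = adj-∩⁻ a in adj-∩⁺ (G.symmetric b) (H.symmetric c)
    ; irreflexive = λ a → let (b , _) = adj-∩⁻ a in G.irreflexive b
    }
    where
    module G = Simple g-simple
    module H = Simple h-simple

  ∩-≼ˡ : (g ∩ᴳ h) ≼ g
  ∩-≼ˡ = ⟨ (λ v∈ → proj₁ (x∈p∩q⁻ _ _ v∈)) , (λ _ a → proj₁ (adj-∩⁻ a)) ⟩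

  ∩-≼ʳ : (g ∩ᴳ h) ≼ h
  ∩-≼ʳ = ⟨ (λ v∈ → proj₂ (x∈p∩q⁻ _ _ v∈)) , (λ _ a → proj₂ (adj-∩⁻ a)) ⟩

  ≼-∩ : ∀ {s} → s ≼ g → s ≼ h → s ≼ (g ∩ᴳ h)
  ≼-∩ ⟨ V , N ⟩ ⟨ V′ , N′ ⟩ =
    ⟨ (λ v∈ → x∈p∩q⁺ (V v∈ , V′ v∈)) , (λ u a → adj-∩⁺ (N u a) (N′ u a)) ⟩

≼-trans : ∀ {s g h : Graph n} → s ≼ g → g ≼ h → s ≼ h
≼-trans ⟨ V , N ⟩ ⟨ V′ , N′ ⟩ = ⟨ (λ v∈ → V′ (V v∈)) , (λ u a → N′ u (N u a)) ⟩

-- With `≼-⋂` this makes the iterated intersection a greatest lower bound, so permuting the factors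
-- calls for no rearrangement of the fold.
⋂-≼ : ∀ (G : Fin (suc m) → Graph n) j → foldr₁ _∩ᴳ_ (tabulate G) ≼ G j
⋂-≼ {zero}  G zero    = ≼-refl
⋂-≼ {suc m} G zero    = ∩-≼ˡ (G zero) _
⋂-≼ {suc m} G (suc j) = ≼-trans (∩-≼ʳ (G zero) _) (⋂-≼ (G ∘ suc) j)

≼-⋂ : ∀ (G : Fin (suc m) → Graph n) {s} → (∀ j → s ≼ G j) → s ≼ foldr₁ _∩ᴳ_ (tabulate G)
≼-⋂ {zero}  G s≼ = s≼ zero
≼-⋂ {suc m} G s≼ = ≼-∩ (G zero) _ (s≼ zero) (≼-⋂ (G ∘ suc) (s≼ ∘ suc))

⋂-simple : ∀ (G : Fin (suc m) → Graph n) → (∀ j → Simple (G j)) →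
           Simple (foldr₁ _∩ᴳ_ (tabulate G))
⋂-simple {zero}  G G-simple = G-simple zero
⋂-simple {suc m} G G-simple =
  ∩-simple (G zero) _ (G-simple zero) (⋂-simple (G ∘ suc) (G-simple ∘ suc))

-- Linear combinations of invariants are assumed for simple graphs only; this allows them to be
-- evaluated in the local graphs themselves.
local-simple : ∀ {r d} .(k≤n : suc m ℕ.≤ n) {G} → Local r d k≤n G → Simple G
local-simple {r = r} k≤n (g , π , g-simple , _ , _ , refl) =
  ⋂-simple (λ j → U r (fixed k≤n j) (image (π ⟨$⟩ʳ_) g)) λ j →
    induced-simple (image-simple (π ⟨$⟩ʳ_) (perm-injective π) g-simple) _

-- Relabelling the fixed points

module _ .(k≤n : k ℕ.≤ n) where

  relabel-fixed : ∀ π j → relabel k≤n π (fixed k≤n j) ≡ fixed k≤n (π ⟨$⟩ʳ j)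
  relabel-fixed π j with toℕ (fixed k≤n j) ℕ.<? k
  ... | yes fj<k = cong (λ j → fixed k≤n (π ⟨$⟩ʳ j)) (toℕ-injective
    (trans (toℕ-fromℕ< fj<k) (toℕ-inject≤ j k≤n)))
  ... | no  fj≮k = contradiction (subst (ℕ._< k) (sym (toℕ-inject≤ j k≤n)) (toℕ<n j)) fj≮k

  relabel-other : ∀ π v → ¬ toℕ v ℕ.< k → relabel k≤n π v ≡ v
  relabel-other π v v≮k with toℕ v ℕ.<? k
  ... | yes v<k = contradiction v<k v≮k
  ... | no  _   = refl

  relabel-inverse : ∀ π π′ → (∀ j → π ⟨$⟩ʳ (π′ ⟨$⟩ʳ j) ≡ j) →
                    ∀ v → relabel k≤n π (relabel k≤n π′ v) ≡ v
  relabel-inverse π π′ ππ′≗id v with toℕ v ℕ.<? k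
  ... | yes v<k = trans (relabel-fixed π _) (trans (cong (fixed k≤n) (ππ′≗id _))
    (toℕ-injective (trans (toℕ-inject≤ _ k≤n) (toℕ-fromℕ< v<k))))
  ... | no  v≮k = relabel-other π v v≮k

  relabelling : Permutation′ k → Permutation′ n
  relabelling π = permutation (relabel k≤n π) (relabel k≤n (Perm.flip π))
    (relabel-inverse π (Perm.flip π) λ _ → inverseʳ π)
    (relabel-inverse (Perm.flip π) π λ _ → inverseˡ π)

module _ (r : ℕ) .(k≤n : suc m ≤ n) where

  relabel-⋂U-≼ : ∀ π g →
    image (relabel k≤n π) (⋂U r k≤n g) ≼ ⋂U r k≤n (image (relabel k≤n π) g)
  relabel-⋂U-≼ π g = ≼-⋂ (λ j → U r (fixed k≤n j) (image ρ g)) λ j →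
    -- The factor around the fixed point `j` comes from the one around its preimage under `π`.
    ≼-trans (image-mono ρ (⋂-≼ (λ j → U r (fixed k≤n j) g) (π ⟨$⟩ˡ j)))
      (subst (λ i → image ρ (U r (fixed k≤n (π ⟨$⟩ˡ j)) g) ≼ U r i (image ρ g))
        (trans (relabel-fixed k≤n π (π ⟨$⟩ˡ j)) (cong (fixed k≤n) (inverseʳ π)))
        (image-U-≼ ρ r _ g))
    where ρ = relabel k≤n π

  relabel-⋂U : ∀ π g →
    image (relabel k≤n π) (⋂U r k≤n g) ≡ ⋂U r k≤n (image (relabel k≤n π) g)
  relabel-⋂U π g = ≼-antisym (relabel-⋂U-≼ π g)
    -- The inclusion for the inverse relabelling and the graph `image ρ g` is pushed forward along
    -- `ρ`.
    (subst (_≼ image ρ (⋂U r k≤n g)) (image-inverse ρρ⁻≗id (⋂U r k≤n (image ρ g)))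
      (image-mono ρ (subst (λ g′ → image ρ⁻ (⋂U r k≤n (image ρ g)) ≼ ⋂U r k≤n g′)
        (image-inverse ρ⁻ρ≗id g) (relabel-⋂U-≼ (Perm.flip π) (image ρ g)))))
    where
    ρ  = relabel k≤n π
    ρ⁻ = relabel k≤n (Perm.flip π)
    ρρ⁻≗id : ρ ∘ ρ⁻ ≗ (λ v → v)
    ρρ⁻≗id = relabel-inverse k≤n π (Perm.flip π) λ _ → inverseʳ π
    ρ⁻ρ≗id : ρ⁻ ∘ ρ ≗ (λ v → v)
    ρ⁻ρ≗id = relabel-inverse k≤n (Perm.flip π) π λ _ → inverseˡ π

  -- Conjugation by `π` is absorbed into the permutation applied to the ambient graph. This closure
  -- is what gives a conjugate local graph a representative.
  local-relabel : ∀ {d} π {G} → Local r d k≤n G → Local r d k≤n (image (relabel k≤n π) G)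
  local-relabel π (g , σ , g-simple , g-spanning , g-deg , refl) =
    g , σ ∘ₚ relabelling k≤n π , g-simple , g-spanning , g-deg
      , trans (relabel-⋂U π (image (σ ⟨$⟩ʳ_) g))
              (cong (⋂U r k≤n) (image-∘ (relabel k≤n π) (σ ⟨$⟩ʳ_) g))

-- Counting

∣⟪⟫∣ : ∀ {p} {P : Pred (Fin n) p} (P? : Decidable P) →
       ∣ ⟪ P? ⟫ ∣ ≡ sum (λ v → if does (P? v) then 1 else 0)
∣⟪⟫∣ P? = trans (∣p∣≡∑ ⟪ P? ⟫)
  (sum-cong-≗ λ v → cong (if_then 1 else 0) (lookup∘tabulate (does ∘ P?) v))

module _ {a p} {A : Set a} {P : Pred A p} (P? : Decidable P) where

  length-filter-∷ : ∀ x xs →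
    length (filter P? (x List.∷ xs)) ≡ (if does (P? x) then 1 else 0) ℕ.+ length (filter P? xs)
  length-filter-∷ x xs with does (P? x)
  ... | true  = refl
  ... | false = refl

  length-filter-none : (∀ x → ¬ P x) → ∀ xs → length (filter P? xs) ≡ 0
  length-filter-none ¬P xs = cong length (filter-none P? (All.universal ¬P xs))

  length-filter-single : ∀ {x xs} → List.Unique xs → x ∈ᴸ xs → P x → (∀ {y} → P y → y ≡ x) →
                         length (filter P? xs) ≡ 1
  length-filter-single {x} {xs = _ List.∷ xs} (x∉ AllPairs.∷ _) (here refl) px P⇒≡x =
    trans (cong length (filter-accept P? px))
          (cong (suc ∘ length) (filter-none P? (All.map (λ x≢y py → x≢y (sym (P⇒≡x py))) x∉)))
  length-filter-single (y∉ AllPairs.∷ xs!) (there x∈) px P⇒≡x =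
    trans (cong length (filter-reject P? λ py → All.lookup y∉ x∈ (P⇒≡x py)))
          (length-filter-single xs! x∈ px P⇒≡x)

-- Pairs `(v , x)` with `P v x` are counted by `v` on the left and by `x` on the right: an `x`
-- satisfying `Q` contributes `c`, any other contributes nothing.
double-count : ∀ {a p q} {A : Set a} {P : Fin n → Pred A p} {Q : Pred A q}
  (P? : ∀ v → Decidable (P v)) (Q? : Decidable Q) (c : ℕ) →
  (∀ {v x} → P v x → Q x) → (∀ x → Q x → ∣ ⟪ (λ v → P? v x) ⟫ ∣ ≡ c) →
  ∀ xs → sum (λ v → length (filter (P? v) xs)) ≡ c ℕ.* length (filter Q? xs)
double-count {n} P? Q? c P⇒Q fibre List.[] =
  trans (ℕ-sum.sum-zero {n} {λ _ → 0} λ _ → refl) (sym (ℕ.*-zeroʳ c))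
double-count {n} P? Q? c P⇒Q fibre (x List.∷ xs) = begin
  sum (λ v → length (filter (P? v) (x List.∷ xs)))
    ≡⟨ sum-cong-≗ (λ v → length-filter-∷ (P? v) x xs) ⟩
  sum (λ v → (if does (P? v x) then 1 else 0) ℕ.+ length (filter (P? v) xs))
    ≡⟨ ∑-distrib-+ (λ v → if does (P? v x) then 1 else 0) (λ v → length (filter (P? v) xs)) ⟩
  sum (λ v → if does (P? v x) then 1 else 0) ℕ.+ sum (λ v → length (filter (P? v) xs))
    ≡⟨ cong₂ ℕ._+_ (sym (∣⟪⟫∣ (λ v → P? v x))) (double-count P? Q? c P⇒Q fibre xs) ⟩
  ∣ ⟪ (λ v → P? v x) ⟫ ∣ ℕ.+ c ℕ.* length (filter Q? xs)
    ≡⟨ step ⟩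
  c ℕ.* length (filter Q? (x List.∷ xs)) ∎
  where
  open ≡-Reasoning
  step : ∣ ⟪ (λ v → P? v x) ⟫ ∣ ℕ.+ c ℕ.* length (filter Q? xs)
         ≡ c ℕ.* length (filter Q? (x List.∷ xs))
  step with Q? x
  ... | yes qx = trans (cong (ℕ._+ _) (fibre x qx)) (sym (ℕ.*-suc c _))
  ... | no ¬qx = cong (ℕ._+ _) (trans
    (cong ∣_∣ (Empty-unique λ (v , v∈) → ¬qx (P⇒Q (∈⟪⟫⁻ (λ v → P? v x) v∈)))) (∣⊥∣≡0 n))

vecs-unique : ∀ {a} {A : Set a} {xs : List A} → List.Unique xs → ∀ n → List.Unique (vecs xs n)
vecs-unique xs! zero    = All.[] AllPairs.∷ AllPairs.[]
vecs-unique xs! (suc n) = cartesianProductWith⁺ _∷_ ∷-injective xs! (vecs-unique xs! n)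

subsets-unique : ∀ n → List.Unique (subsets n)
subsets-unique = vecs-unique (((λ ()) All.∷ All.[]) AllPairs.∷ All.[] AllPairs.∷ AllPairs.[])

-- The invariants are lengths of filtered sublists of this enumeration; without repetitions, a
-- single copy is counted exactly once.
graphs-unique : ∀ n → List.Unique (graphs n)
graphs-unique n = cartesianProductWith⁺ mkGraph (λ { refl → refl , refl })
  (subsets-unique n) (vecs-unique (subsets-unique n) n)

lookup-∷ʳ-inject₁ : ∀ {a} {A : Set a} (xs : Vec A k) x j →
                    lookup (xs ∷ʳ x) (inject₁ j) ≡ lookup xs j
lookup-∷ʳ-inject₁ (_ ∷ _)  x zero    = refl
lookup-∷ʳ-inject₁ (_ ∷ xs) x (suc j) = lookup-∷ʳ-inject₁ xs x j

lookup-∷ʳ-fromℕ : ∀ {a} {A : Set a} (xs : Vec A k) x → lookup (xs ∷ʳ x) (fromℕ k) ≡ x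
lookup-∷ʳ-fromℕ []       x = refl
lookup-∷ʳ-fromℕ (_ ∷ xs) x = lookup-∷ʳ-fromℕ xs x

-- Local invariants

module _ .(k≤n : k ≤ n) where

  copy? : ∀ g h i → Decidable λ s → s ⊑ h × IsImage k≤n g i s
  copy? g h i s = (s ⊑? h) ×-dec isImage? k≤n g i s

  I-cong : ∀ (g g′ : Graph n) i i′ → (∀ {s} → IsImage k≤n g i s ⇔ IsImage k≤n g′ i′ s) →
           ∀ h → I k≤n g h i ≡ I k≤n g′ h i′
  I-cong g g′ i i′ eq h = cong length (filter-≐ (copy? g h i) (copy? g′ h i′)
    ( (λ (s⊑h , im) → s⊑h , Equivalence.to eq im)
    , (λ (s⊑h , im) → s⊑h , Equivalence.from eq im))
    (graphs n))

  isImage-resp-iso : ∀ g g′ i {s} → Iso k≤n g g′ → IsImage k≤n g′ i s → IsImage k≤n g i s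
  isImage-resp-iso g _ i (σ , σ-fixes , refl) (f , f-inj , f-pins , eq) =
    f ∘ (σ ⟨$⟩ʳ_) , perm-injective σ ∘ f-inj , (λ j → trans (cong f (σ-fixes j)) (f-pins j))
      , trans (sym (image-∘ f (σ ⟨$⟩ʳ_) g)) eq

  I-iso : ∀ g g′ → Iso k≤n g g′ → ∀ h i → I k≤n g h i ≡ I k≤n g′ h i
  I-iso g g′ g≅g′ h i = I-cong g g′ i i
    (mk⇔ (isImage-resp-iso g′ g i (iso-sym k≤n g g′ g≅g′)) (isImage-resp-iso g g′ i g≅g′)) h

  I-relabel : ∀ π g h i →
    I k≤n (image (relabel k≤n π) g) h i ≡ I k≤n g h (tabulate λ j → lookup i (π ⟨$⟩ʳ j))
  I-relabel π g h i = I-cong (image ρ g) g i (tabulate λ j → lookup i (π ⟨$⟩ʳ j)) (mk⇔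
    (λ (f , f-inj , f-pins , eq) → f ∘ ρ , perm-injective (relabelling k≤n π) ∘ f-inj
      , (λ j → trans (cong f (relabel-fixed k≤n π j))
          (trans (f-pins (π ⟨$⟩ʳ j)) (sym (lookup∘tabulate _ j))))
      , trans (sym (image-∘ f ρ g)) eq)
    (λ (f , f-inj , f-pins , eq) → f ∘ ρ⁻
      , perm-injective (relabelling k≤n (Perm.flip π)) ∘ f-inj
      , (λ j → trans (cong f (relabel-fixed k≤n (Perm.flip π) j))
          (trans (f-pins (π ⟨$⟩ˡ j))
            (trans (lookup∘tabulate _ (π ⟨$⟩ˡ j)) (cong (lookup i) (inverseʳ π)))))
      , trans (image-∘ (f ∘ ρ⁻) ρ g)
          (trans (image-cong (λ v → cong f (inverseˡ (relabelling k≤n π))) g) eq))) h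
    where
    ρ  = relabel k≤n π
    ρ⁻ = relabel k≤n (Perm.flip π)

  -- Pinned at 1,...,k, the map fixes these points, and an injective self-map of a finite set is a
  -- permutation.
  isImage⇒iso : ∀ g s → IsImage k≤n g (tabulate (fixed k≤n)) s → Iso k≤n g s
  isImage⇒iso _ _ (f , f-inj , f-pins , eq) = injective⇒permutation f f-inj
    , (λ j → trans (f-pins j) (lookup∘tabulate _ j)) , eq

  isImage⇒weight≡ : ∀ g i {s} → IsImage k≤n g i s → weight s ≡ weight g
  isImage⇒weight≡ g _ (f , f-inj , _ , refl) = weight-image (injective⇒permutation f f-inj) g

  -- A copy of `g` inside `g` has the weight of `g`, so it is all of `g`; the identity provides this
  -- copy.
  I₀-diagonal : ∀ g → I₀ k≤n g g ≡ 1
  I₀-diagonal g = length-filter-single (copy? g g (tabulate (fixed k≤n)))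
    (graphs-unique n) (∈-graphs g)
    ( inclusion (≼-refl {g = g})
    , (λ v → v) , (λ eq → eq) , (λ j → sym (lookup∘tabulate _ j)) , image-id g)
    (λ {s} (s⊑g , im) → ≼∧weight≡⇒≡ {s = s} {g = g} ⟨ s⊑g ⟩
      (isImage⇒weight≡ g (tabulate (fixed k≤n)) im))

  -- A copy of `g` inside `g′` has at most the weight of `g′`, and by assumption at least that
  -- weight. It would therefore fill `g′` and make the two graphs isomorphic.
  I₀-zero : ∀ g g′ → ¬ Iso k≤n g g′ → ¬ weight g ℕ.< weight g′ → I₀ k≤n g g′ ≡ 0
  I₀-zero g g′ g≇g′ wg≮wg′ =
    length-filter-none (copy? g g′ (tabulate (fixed k≤n))) ¬copy (graphs n)
    where
    ¬copy : ∀ s → ¬ (s ⊑ g′ × IsImage k≤n g (tabulate (fixed k≤n)) s)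
    ¬copy s (s⊑g′ , im) = g≇g′ (subst (Iso k≤n g) s≡g′ (isImage⇒iso g s im))
      where
      s≼g′ : s ≼ g′
      s≼g′ = ⟨ s⊑g′ ⟩
      s≡g′ : s ≡ g′
      s≡g′ = ≼∧weight≡⇒≡ s≼g′ (ℕ.≤-antisym (≼⇒weight≤ s≼g′)
        (subst (weight g′ ≤_) (sym (isImage⇒weight≡ g (tabulate (fixed k≤n)) im)) (ℕ.≮⇒≥ wg≮wg′)))

-- Conjugate equations and products of invariants

module _ {m n r d} .(k≤n : suc m ≤ n) (ℰ : Representatives r d k≤n) where

  conjugate : ∀ h i π → IsConjugate ℰ π (z ℰ h i) (z ℰ h (tabulate λ j → lookup i (π ⟨$⟩ʳ j)))
  conjugate h i π t =
    let g = graph ℰ t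
        t′ , iso = complete ℰ (image (relabel k≤n π) g) (local-relabel r k≤n π (local ℰ t))
          (let v , v∈ = nonempty ℰ t in relabel k≤n π v , vertex-image⁺ (relabel k≤n π) g v∈)
    in t′ , iso
       , trans (sym (I-relabel k≤n π g h i))
           (I-iso k≤n (image (relabel k≤n π) g) (graph ℰ t′) iso h i)

  E-unitriangular : IsUnitriangular (weight ∘ graph ℰ) (E ℰ)
  E-unitriangular = record
    { diagonal = λ a → cong _↑ℚ (I₀-diagonal k≤n (graph ℰ a))
    ; zeros    = λ a b a≢b wb≮wa → cong _↑ℚ (I₀-zero k≤n (graph ℰ b) (graph ℰ a)
        (λ iso → a≢b (sym (distinct ℰ b a iso))) wb≮wa)
    }

  E-invertible : ∃[ E⁻¹ ] Linearℚ.IsInverse (E ℰ) E⁻¹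
  E-invertible = unitriangular⇒invertible E-unitriangular

  product≡E⁻¹p∙z : ∀ {E⁻¹} → Linearℚ.IsInverse (E ℰ) E⁻¹ →
    ∀ {a b} → ProductIsLinearCombination ℰ a b →
    ∀ h → Simple h → ∀ i → Unique i →
    z ℰ h i a ↑ℚ *ℚ z ℰ h i b ↑ℚ ≡ (E⁻¹ Linearℚ.·ⱽ p ℰ a b) Linearℚ.∙ (λ t → z ℰ h i t ↑ℚ)
  product≡E⁻¹p∙z {E⁻¹} inverse {a} {b} (c , lin) h h-simple i i! = trans (lin h h-simple i i!)
    (ℚ-sum.sum-cong-≗ λ t → cong (_*ℚ z ℰ h i t ↑ℚ) (c≡E⁻¹p t))
    where
    -- At (1,...,k) in `graph ℰ t` the vector `z` is by definition row `t` of `E`, and the product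
    -- is entry `t` of `p`.
    Ec≡p : ∀ t → (E ℰ Linearℚ.·ⱽ c) t ≡ p ℰ a b t
    Ec≡p t = trans (ℚ-sum.sum-cong-≗ λ u → ℚ.*-comm (E ℰ t u) (c u))
      (sym (lin (graph ℰ t) (local-simple {r = r} k≤n (local ℰ t)) (tabulate (fixed k≤n))
        (tabulate⁺ λ {u} {v} → inject≤-injective k≤n k≤n u v)))
    c≡E⁻¹p : ∀ t → c t ≡ (E⁻¹ Linearℚ.·ⱽ p ℰ a b) t
    c≡E⁻¹p = ℚ-sum.inverse-solves (E ℰ) E⁻¹ inverse Ec≡p

-- Summation over the last fixed point

module _ .(k≤n : suc k ≤ n) where

  fixed-inject₁ : ∀ (j : Fin k) → fixed k≤n (inject₁ j) ≡ fixed (<⇒≤ k≤n) j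
  fixed-inject₁ j = toℕ-injective (trans (toℕ-inject≤ (inject₁ j) k≤n)
    (trans (toℕ-inject₁ j) (sym (toℕ-inject≤ j (<⇒≤ k≤n)))))

  new : Fin n
  new = fixed k≤n (fromℕ k)

  pins-∷ʳ⁺ : ∀ i {v f} → Pins (<⇒≤ k≤n) i f → f new ≡ v → Pins k≤n (i ∷ʳ v) f
  pins-∷ʳ⁺ i {v} {f} f-pins f-new j with view j
  ... | ‵fromℕ     = trans f-new (sym (lookup-∷ʳ-fromℕ i v))
  ... | ‵inject₁ j = trans (cong f (fixed-inject₁ j))
      (trans (f-pins j) (sym (lookup-∷ʳ-inject₁ i v j)))

  pins-∷ʳ⁻ : ∀ i {v f} → Pins k≤n (i ∷ʳ v) f → Pins (<⇒≤ k≤n) i f × f new ≡ v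
  pins-∷ʳ⁻ i {v} {f} f-pins =
      (λ j → trans (cong f (sym (fixed-inject₁ j)))
          (trans (f-pins (inject₁ j)) (lookup-∷ʳ-inject₁ i v j)))
    , trans (f-pins (fromℕ k)) (lookup-∷ʳ-fromℕ i v)

  -- Otherwise `f` would take the value `v` both at the last fixed point and at an earlier one.
  -- Hence the terms left out of `z-sum` are zero, and the sum may run over all vertices.
  isImage-∷ʳ⇒∉ : ∀ g i {v s} → IsImage k≤n g (i ∷ʳ v) s → ¬ v ∈ⱽ i
  isImage-∷ʳ⇒∉ g i {v} (f , f-inj , f-pins , _) v∈i =
    let f-pins⁻ , f-new = pins-∷ʳ⁻ i {f = f} f-pins
        j = index v∈i
    in fromℕ≢inject₁ (inject≤-injective k≤n k≤n (fromℕ k) (inject₁ j) (f-inj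
      (trans f-new (trans (lookup-index v∈i)
        (sym (trans (cong f (fixed-inject₁ j)) (f-pins⁻ j)))))))

module _ {m n r d} .(k≤n : suc (suc m) ≤ n)
         (ℰ : Representatives r d k≤n) (ℰ⁻ : Representatives r d (<⇒≤ k≤n)) where

  open DecMembership (_≟_ {n}) using () renaming (_∈?_ to _∈ⱽ?_)

  Moves : Fin (size ℰ) → Fin n → (Fin n → Fin n) → Set
  Moves t v f = Fixes (<⇒≤ k≤n) f × image f (graph ℰ t) ≡ graph ℰ t × f (new k≤n) ≡ v

  Reaches : Fin (size ℰ) → Fin n → Set
  Reaches t v = ∃[ σ ] Moves t v (σ ⟨$⟩ʳ_)

  -- The decision procedure inside orbit, which has no name there.
  reaches? : ∀ t → Decidable (Reaches t)
  reaches? t v = anyPerm? {P = Moves t v}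
    (λ f≗f′ (fx , e , q) → (λ j → trans (sym (f≗f′ _)) (fx j))
                         , trans (sym (image-cong f≗f′ (graph ℰ t))) e
                         , trans (sym (f≗f′ _)) q)
    (λ f → all? (λ j → f (fixed (<⇒≤ k≤n) j) ≟ fixed (<⇒≤ k≤n) j)
           ×-dec (image f (graph ℰ t) ≟ᴳ graph ℰ t) ×-dec (f (new k≤n) ≟ v))

  ∈-orbit⁺ : ∀ t {v} → Reaches t v → v ∈ orbit ℰ ℰ⁻ t
  ∈-orbit⁺ t = ∈⟪⟫⁺ (reaches? t)

  ∈-orbit⁻ : ∀ t {v} → v ∈ orbit ℰ ℰ⁻ t → Reaches t v
  ∈-orbit⁻ t = ∈⟪⟫⁻ (reaches? t)

  -- One map `f₀` onto `s` is chosen and read as a permutation; it carries the orbit of the last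
  -- fixed point onto the set of values `v` counted on the left.
  ∣extensions∣ : ∀ h i t s → s ⊑ h × IsImage (<⇒≤ k≤n) (graph ℰ t) i s →
                 ∣ ⟪ (λ v → copy? k≤n (graph ℰ t) h (i ∷ʳ v) s) ⟫ ∣ ≡ ∣ orbit ℰ ℰ⁻ t ∣
  ∣extensions∣ h i t s (s⊑h , f₀ , f₀-inj , f₀-pins , f₀g≡s) = sym (∣∣-permute φ λ v → mk⇔
    (λ v∈ → ∈⟪⟫⁺ (λ v → copy? k≤n (graph ℰ t) h (i ∷ʳ v) s) (s⊑h , extend (∈-orbit⁻ t v∈)))
    (λ v∈ → ∈-orbit⁺ t (restrict (proj₂ (∈⟪⟫⁻ (λ v → copy? k≤n (graph ℰ t) h (i ∷ʳ v) s) v∈)))))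
    where
    g : Graph n
    g = graph ℰ t
    φ : Permutation′ n
    φ = injective⇒permutation f₀ f₀-inj
    f₀⁻¹ : Fin n → Fin n
    f₀⁻¹ = φ ⟨$⟩ˡ_
    extend : ∀ {v} → Reaches t v → IsImage k≤n g (i ∷ʳ f₀ v) s
    extend (σ , σ-fixes , σg≡g , σ-new) = f₀ ∘ (σ ⟨$⟩ʳ_) , perm-injective σ ∘ f₀-inj
      , pins-∷ʳ⁺ k≤n i {f = f₀ ∘ (σ ⟨$⟩ʳ_)}
          (λ j → trans (cong f₀ (σ-fixes j)) (f₀-pins j)) (cong f₀ σ-new)
      , trans (sym (image-∘ f₀ (σ ⟨$⟩ʳ_) g)) (trans (cong (image f₀) σg≡g) f₀g≡s)
    -- Two maps of `g` onto `s` with the same first pins differ by an element of the stabilizer: `f`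
    -- followed by the inverse of `f₀`.
    restrict : ∀ {v} → IsImage k≤n g (i ∷ʳ f₀ v) s → Reaches t v
    restrict (f , f-inj , f-pins , fg≡s) =
      let f-pins⁻ , f-new = pins-∷ʳ⁻ k≤n i {f = f} f-pins
      in injective⇒permutation f f-inj ∘ₚ Perm.flip φ
        , (λ j → trans (cong f₀⁻¹ (trans (f-pins⁻ j) (sym (f₀-pins j)))) (inverseˡ φ))
        , trans (sym (image-∘ f₀⁻¹ f g)) (trans (cong (image f₀⁻¹) (trans fg≡s (sym f₀g≡s)))
            (image-inverse (λ _ → inverseˡ φ) g))
        , trans (cong f₀⁻¹ f-new) (inverseˡ φ)

  -- Pairs of a copy `s` and a value `v` at the last fixed point are counted twice, each copy pinned
  -- at `i` admitting as many values as the orbit has elements.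
  z-sum≡∣orbit∣* : ∀ h i t → z-sum ℰ ℰ⁻ h i t ≡ ∣ orbit ℰ ℰ⁻ t ∣ ℕ.* I (<⇒≤ k≤n) (graph ℰ t) h i
  z-sum≡∣orbit∣* h i t = trans (sum-cong-≗ summand)
    (double-count (λ v → copy? k≤n (graph ℰ t) h (i ∷ʳ v)) (copy? (<⇒≤ k≤n) (graph ℰ t) h i)
      ∣ orbit ℰ ℰ⁻ t ∣
      (λ (s⊑h , f , f-inj , f-pins , eq) →
        s⊑h , f , f-inj , proj₁ (pins-∷ʳ⁻ k≤n i {f = f} f-pins) , eq)
      (∣extensions∣ h i t) (graphs n))
    where
    summand : ∀ v → (if does (v ∈ⱽ? i) then 0 else z ℰ h (i ∷ʳ v) t)
                    ≡ length (filter (copy? k≤n (graph ℰ t) h (i ∷ʳ v)) (graphs n))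
    summand v with v ∈ⱽ? i
    ... | yes v∈i = sym (length-filter-none (copy? k≤n (graph ℰ t) h (i ∷ʳ v))
      (λ s (_ , im) → isImage-∷ʳ⇒∉ k≤n (graph ℰ t) i im v∈i) (graphs n))
    ... | no  _   = refl

  -- Row `t` of `P` has its only 1 in column `u`: a second representative isomorphic to `graph ℰ t`
  -- would be isomorphic to the first, contrary to `distinct`.
  P-·ⱽ : ∀ t {u} → Iso (<⇒≤ k≤n) (graph ℰ t) (graph ℰ⁻ u) → ∀ x → (P ℰ ℰ⁻ Linearℕ.·ⱽ x) t ≡ x u
  P-·ⱽ t {u} t≅u x = begin
    (P ℰ ℰ⁻ Linearℕ.·ⱽ x) t
      ≡⟨ ℕ-sum.sum-single (λ v → P ℰ ℰ⁻ t v ℕ.* x v) u (λ v v≢u →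
           cong (λ b → (if b then 1 else 0) ℕ.* x v) (dec-false (iso? (<⇒≤ k≤n) g (graph ℰ⁻ v))
             λ t≅v → v≢u (distinct ℰ⁻ v u (iso-trans (<⇒≤ k≤n) (graph ℰ⁻ v) g (graph ℰ⁻ u)
               (iso-sym (<⇒≤ k≤n) g (graph ℰ⁻ v) t≅v) t≅u)))) ⟩
    P ℰ ℰ⁻ t u ℕ.* x u
      ≡⟨ cong (λ b → (if b then 1 else 0) ℕ.* x u)
           (dec-true (iso? (<⇒≤ k≤n) g (graph ℰ⁻ u)) t≅u) ⟩
    1 ℕ.* x u
      ≡⟨ ℕ.*-identityˡ (x u) ⟩
    x u ∎
    where
    open ≡-Reasoning
    g = graph ℰ t

  z-sum≡DPz : ∀ h i t → Restricts ℰ ℰ⁻ t →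
    z-sum ℰ ℰ⁻ h i t ≡ (D ℰ ℰ⁻ Linearℕ.·ⱽ P ℰ ℰ⁻ Linearℕ.·ⱽ z ℰ⁻ h i) t
  z-sum≡DPz h i t (u , t≅u) = begin
    z-sum ℰ ℰ⁻ h i t
      ≡⟨ z-sum≡∣orbit∣* h i t ⟩
    ∣ orbit ℰ ℰ⁻ t ∣ ℕ.* I (<⇒≤ k≤n) (graph ℰ t) h i
      ≡⟨ cong (∣ orbit ℰ ℰ⁻ t ∣ ℕ.*_) (I-iso (<⇒≤ k≤n) (graph ℰ t) (graph ℰ⁻ u) t≅u h i) ⟩
    ∣ orbit ℰ ℰ⁻ t ∣ ℕ.* z ℰ⁻ h i u
      ≡⟨ cong (∣ orbit ℰ ℰ⁻ t ∣ ℕ.*_) (P-·ⱽ t t≅u (z ℰ⁻ h i)) ⟨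
    ∣ orbit ℰ ℰ⁻ t ∣ ℕ.* (P ℰ ℰ⁻ Linearℕ.·ⱽ z ℰ⁻ h i) t
      ≡⟨ ℕ-sum.diag-·ⱽ (λ t → ∣ orbit ℰ ℰ⁻ t ∣) (P ℰ ℰ⁻ Linearℕ.·ⱽ z ℰ⁻ h i) t ⟨
    (D ℰ ℰ⁻ Linearℕ.·ⱽ P ℰ ℰ⁻ Linearℕ.·ⱽ z ℰ⁻ h i) t ∎
    where open ≡-Reasoning

corollary2 : ∀ {n r d : ℕ} → 1 ≤ r → 1 ≤ d →
    (h : Graph n) → Simple h → Spanning h →
    (ℰ : ∀ {m} .(k≤n : suc m ≤ n) → Representatives r d k≤n) →
    (∀ {m} .(k≤n : suc m ≤ n) (i : Vec (Fin n) (suc m)) → Unique i →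
    (π : Permutation′ (suc m)) →
    IsConjugate (ℰ k≤n) π (z (ℰ k≤n) h i) (z (ℰ k≤n) h (tabulate (λ j → lookup i (π ⟨$⟩ʳ j)))))
    × (∀ {m} .(k≤n : suc (suc m) ≤ n) (i : Vec (Fin n) (suc m)) → Unique i →
    (t : Fin (size (ℰ k≤n))) → Restricts (ℰ k≤n) (ℰ (<⇒≤ k≤n)) t →
    z-sum (ℰ k≤n) (ℰ (<⇒≤ k≤n)) h i t
    ≡ (D (ℰ k≤n) (ℰ (<⇒≤ k≤n)) Linearℕ.·ⱽ P (ℰ k≤n) (ℰ (<⇒≤ k≤n)) Linearℕ.·ⱽ z (ℰ (<⇒≤ k≤n)) h i) t)
    × (∀ {m} .(k≤n : suc m ≤ n) →
    ∃[ E⁻¹ ] Linearℚ.IsInverse (E (ℰ k≤n)) E⁻¹ ×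
    (∀ (i : Vec (Fin n) (suc m)) → Unique i →
    ∀ a b → ProductIsLinearCombination (ℰ k≤n) a b →
    z (ℰ k≤n) h i a ↑ℚ *ℚ z (ℰ k≤n) h i b ↑ℚ
    ≡ (E⁻¹ Linearℚ.·ⱽ p (ℰ k≤n) a b) Linearℚ.∙ (λ t → z (ℰ k≤n) h i t ↑ℚ)))
corollary2 _ _ h h-simple _ ℰ =
    (λ k≤n i _ π → conjugate k≤n (ℰ k≤n) h i π)
  , (λ k≤n i _ t → z-sum≡DPz k≤n (ℰ k≤n) (ℰ (<⇒≤ k≤n)) h i t)
  , (λ k≤n → let E⁻¹ , inverse = E-invertible k≤n (ℰ k≤n) in
      E⁻¹ , inverse , λ i i! a b lin → product≡E⁻¹p∙z k≤n (ℰ k≤n) inverse lin h h-simple i i!)
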